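{- Let $$P=\operatorname{conv}\{(0,2,5),\,(0,-2,5),\,(0,1,-6),\,(1,-8,5),\,(1,2,-5),\,(1,-4,-3)\}\subset\mathbb{R}^3.$$ Then $P$ is a lattice polytope of lattice width one, and there is no basis of $\mathbb{Z}^3$ that is reduced with respect to $P$ and computes the lattice size $\operatorname{ls}_\Delta(P)$.
   Context: A lattice polytope in $\mathbb{R}^d$ is a convex polytope all of whose vertices lie in $\mathbb{Z}^d$. $\mathrm{AGL}(d,\mathbb{Z})$ is the group of affine unimodular maps $T(x)=Ax+h$ with $A\in\mathrm{GL}(d,\mathbb{Z})$ and $h\in\mathbb{Z}^d$. $\Delta=\operatorname{conv}\{0,e_1,e_2,e_3\}\subset\mathbb{R}^3$ is the standard simplex. For a matrix $A$, $AP=\{Ax: x\in P\}$. Lattice size: $\operatorname{ls}_\Delta(P)$ is the smallest $l\ge 0$ such that $T(P)\subset l\Delta$ for some $T\in \mathrm{AGL}(3,\mathbb{Z})$. Naive lattice size: $\operatorname{nls}_\Delta(P)$ is the smallest $l$ such that $T(P)\subset l\Delta$ for some $T$ that is a composition of multiplication by a diagonal matrix with entries $\pm1$ on the diagonal and a lattice translation. A basis $(h_1,h_2,h_3)$ of $\mathbb{Z}^3$ computes $\operatorname{ls}_\Delta(P)$ if $\operatorname{ls}_\Delta(P)=\operatorname{nls}_\Delta(AP)$, where $A$ is the matrix with rows $h_1,h_2,h_3$. For $h\in\mathbb{R}^3$, $\operatorname{w}_h(P)=\max_{x\in P}\langle h,x\rangle-\min_{x\in P}\langle h,x\rangle$,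 and the lattice width of $P$ is the minimum of $\operatorname{w}_h(P)$ over nonzero primitive $h\in\mathbb{Z}^3$. Write $\Vert h\Vert=\operatorname{w}_h(P)$. A basis $(h_1,h_2,h_3)$ of $\mathbb{Z}^3$ is reduced with respect to $P$ if (1) $\Vert h_1\Vert\le\Vert h_2\Vert\le\Vert h_3\Vert$; (2) $\Vert h_1\pm h_2\Vert\ge\Vert h_2\Vert$ (both signs); (3) $\Vert mh_1+nh_2+h_3\Vert\ge\Vert h_3\Vert$ for all $m,n\in\mathbb{Z}$. -}

module Defs where

open import Data.Fin.Base using (Fin)
open import Data.Integer.Base as ℤ using (ℤ; +_; -_)
open import Data.Integer.GCD using (gcd)
open import Data.Nat.Base as ℕ using (ℕ; zero; suc; _⊔_)
import Data.Nat.Properties as ℕ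
open import Data.Product.Base using (∃; _×_; _,_)
open import Data.Product using (∃!)
open import Data.Rational.Base as ℚ using (ℚ; 0ℚ; 1ℚ; ∣_∣; 1/_)
import Data.Rational.Properties as ℚ
open import Data.Rational.Solver using (module +-*-Solver)
open import Data.Sum.Base using (_⊎_)
open import Data.Vec.Functional using (Vector; []; _∷_; foldr)
open import Level using (0ℓ)
open import Relation.Binary.PropositionalEquality
  using (_≡_; _≢_; _≗_; refl; sym; cong; subst; trans;
   module ≡-Reasoning)
open import Relation.Unary using (Pred; _⊆_; _≐_)

------------------------------------------------------------------------
-- The real numbers, as Cauchy sequences of rationals.  Two sequences
-- represent the same real when they are related by _≈_.

Eventually : Pred ℕ 0ℓ → Set
Eventually Q = ∃ λ N → ∀ n → N ℕ.≤ n → Q n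

IsCauchy : (ℕ → ℚ) → Set
IsCauchy x = ∀ ε → 0ℚ ℚ.< ε →
  ∃ λ N → ∀ m n → N ℕ.≤ m → N ℕ.≤ n → ∣ x m ℚ.- x n ∣ ℚ.≤ ε

record ℝ : Set where
  no-eta-equality
  field
    seq    : ℕ → ℚ
    cauchy : IsCauchy seq

open ℝ public

infix  4 _≤_ _<_ _≈_
infixl 6 _+_ _-_
infixl 7 _*_
infix  8 -ℝ_

record _≤_ (x y : ℝ) : Set where
  constructor mk≤
  field
    eventually-≤ : ∀ ε → 0ℚ ℚ.< ε →
      Eventually λ n → seq x n ℚ.≤ seq y n ℚ.+ ε

record _<_ (x y : ℝ) : Set where
  constructor mk<
  field
    gap          : ℚ
    0<gap        : 0ℚ ℚ.< gap
    eventually-< : Eventually λ n → seq x n ℚ.+ gap ℚ.≤ seq y n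

open _≤_ public
open _<_ public

_≈_ : ℝ → ℝ → Set
x ≈ y = x ≤ y × y ≤ x

half : ∀ ε → 0ℚ ℚ.< ε → 0ℚ ℚ.< ε ℚ.* ℚ.½
half ε 0<ε = ℚ.<-respˡ-≡ (ℚ.*-zeroˡ ℚ.½) (ℚ.*-monoˡ-<-pos ℚ.½ 0<ε)

halves : ∀ ε → ε ℚ.* ℚ.½ ℚ.+ ε ℚ.* ℚ.½ ≡ ε
halves = solve 1 (λ e → e :* con ℚ.½ :+ e :* con ℚ.½ := e) refl
  where open +-*-Solver

+-cauchy : ∀ x y → IsCauchy x → IsCauchy y → IsCauchy λ n → x n ℚ.+ y n
+-cauchy x y cx cy ε 0<ε with cx _ (half ε 0<ε) | cy _ (half ε 0<ε)
... | N , p | M , q = N ⊔ M , λ m n l k → begin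
  ∣ (x m ℚ.+ y m) ℚ.- (x n ℚ.+ y n) ∣
    ≡⟨ cong ∣_∣ (rearrange (x m) (x n) (y m) (y n)) ⟩
  ∣ (x m ℚ.- x n) ℚ.+ (y m ℚ.- y n) ∣
    ≤⟨ ℚ.∣p+q∣≤∣p∣+∣q∣ (x m ℚ.- x n) (y m ℚ.- y n) ⟩
  ∣ x m ℚ.- x n ∣ ℚ.+ ∣ y m ℚ.- y n ∣
    ≤⟨ ℚ.+-mono-≤ (p m n (ℕ.m⊔n≤o⇒m≤o N M l) (ℕ.m⊔n≤o⇒m≤o N M k))
                  (q m n (ℕ.m⊔n≤o⇒n≤o N M l) (ℕ.m⊔n≤o⇒n≤o N M k)) ⟩
  ε ℚ.* ℚ.½ ℚ.+ ε ℚ.* ℚ.½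
    ≡⟨ halves ε ⟩
  ε ∎
  where
  open ℚ.≤-Reasoning
  open +-*-Solver
  rearrange : ∀ a b c d → (a ℚ.+ c) ℚ.- (b ℚ.+ d) ≡ (a ℚ.- b) ℚ.+ (c ℚ.- d)
  rearrange = solve 4 (λ a b c d →
    (a :+ c) :+ (:- (b :+ d)) := (a :+ (:- b)) :+ (c :+ (:- d))) refl

neg-cauchy : ∀ x → IsCauchy x → IsCauchy λ n → ℚ.- x n
neg-cauchy x cx ε 0<ε with cx ε 0<ε
... | N , p = N , λ m n l k →
  subst (ℚ._≤ ε)
    (trans
      (sym (ℚ.∣-p∣≡∣p∣ (x m ℚ.- x n)))
      (cong ∣_∣ (rearrange (x m) (x n))))
    (p m n l k)
  where
  open +-*-Solver
  rearrange : ∀ a b → ℚ.- (a ℚ.- b) ≡ (ℚ.- a) ℚ.- (ℚ.- b)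
  rearrange = solve 2 (λ a b →
    :- (a :+ (:- b)) := (:- a) :+ (:- (:- b))) refl

bounded : ∀ x → IsCauchy x →
         ∃ λ B → 0ℚ ℚ.< B × Eventually λ n → ∣ x n ∣ ℚ.≤ B
bounded x cx with cx 1ℚ (ℚ.positive⁻¹ 1ℚ)
... | N , p = B , 0<B , N , λ n N≤n → begin
  ∣ x n ∣                          ≡⟨ cong ∣_∣ (split (x n) (x N)) ⟩
  ∣ (x n ℚ.- x N) ℚ.+ x N ∣        ≤⟨ ℚ.∣p+q∣≤∣p∣+∣q∣ (x n ℚ.- x N) (x N) ⟩
  ∣ x n ℚ.- x N ∣ ℚ.+ ∣ x N ∣
    ≤⟨ ℚ.+-monoˡ-≤ ∣ x N ∣ (p n N N≤n ℕ.≤-refl) ⟩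
  B ∎
  where
  open ℚ.≤-Reasoning
  open +-*-Solver
  B = 1ℚ ℚ.+ ∣ x N ∣
  0<B : 0ℚ ℚ.< B
  0<B = ℚ.+-mono-<-≤ (ℚ.positive⁻¹ 1ℚ) (ℚ.0≤∣p∣ (x N))
  split : ∀ a b → a ≡ (a ℚ.- b) ℚ.+ b
  split = solve 2 (λ a b → a := (a :+ (:- b)) :+ b) refl

quotient : ∀ C ε → 0ℚ ℚ.< C → 0ℚ ℚ.< ε → ∃ λ δ → 0ℚ ℚ.< δ × C ℚ.* δ ≡ ε
quotient C ε 0<C 0<ε = (1/ C) ℚ.* ε , 0<δ , eq
  where
  instance
    C-pos : ℚ.Positive C
    C-pos = ℚ.positive 0<C
    C-nonZero : ℚ.NonZero C
    C-nonZero = ℚ.pos⇒nonZero C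
    1/C-pos : ℚ.Positive (1/ C)
    1/C-pos = ℚ.1/pos⇒pos C
  0<δ : 0ℚ ℚ.< (1/ C) ℚ.* ε
  0<δ = ℚ.<-respˡ-≡ (ℚ.*-zeroʳ (1/ C)) (ℚ.*-monoʳ-<-pos (1/ C) 0<ε)
  open ≡-Reasoning
  eq : C ℚ.* ((1/ C) ℚ.* ε) ≡ ε
  eq = begin
    C ℚ.* ((1/ C) ℚ.* ε) ≡⟨ sym (ℚ.*-assoc C (1/ C) ε) ⟩
    C ℚ.* (1/ C) ℚ.* ε   ≡⟨ cong (ℚ._* ε) (ℚ.*-inverseʳ C) ⟩
    1ℚ ℚ.* ε             ≡⟨ ℚ.*-identityˡ ε ⟩
    ε                    ∎

*-mono-∣∣ : ∀ p q {b c} → ∣ p ∣ ℚ.≤ b → ∣ q ∣ ℚ.≤ c → ∣ p ℚ.* q ∣ ℚ.≤ b ℚ.* c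
*-mono-∣∣ p q {b} {c} p≤b q≤c = begin
  ∣ p ℚ.* q ∣       ≡⟨ ℚ.∣p*q∣≡∣p∣*∣q∣ p q ⟩
  ∣ p ∣ ℚ.* ∣ q ∣
    ≤⟨ ℚ.*-monoˡ-≤-nonNeg ∣ p ∣ {{ℚ.nonNegative (ℚ.0≤∣p∣ p)}} q≤c ⟩
  ∣ p ∣ ℚ.* c
    ≤⟨ ℚ.*-monoʳ-≤-nonNeg c
         {{ℚ.nonNegative (ℚ.≤-trans (ℚ.0≤∣p∣ q) q≤c)}} p≤b ⟩
  b ℚ.* c           ∎
  where open ℚ.≤-Reasoning

*-difference : ∀ a b c d →
  a ℚ.* c ℚ.- b ℚ.* d ≡ a ℚ.* (c ℚ.- d) ℚ.+ d ℚ.* (a ℚ.- b)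
*-difference = solve 4 (λ a b c d →
  a :* c :+ (:- (b :* d)) := a :* (c :+ (:- d)) :+ d :* (a :+ (:- b))) refl
  where open +-*-Solver

*-estimate : ∀ a b c d {B C δ} → ∣ a ∣ ℚ.≤ B → ∣ d ∣ ℚ.≤ C →
  ∣ a ℚ.- b ∣ ℚ.≤ δ → ∣ c ℚ.- d ∣ ℚ.≤ δ →
  ∣ a ℚ.* c ℚ.- b ℚ.* d ∣ ℚ.≤ (B ℚ.+ C) ℚ.* δ
*-estimate a b c d {B} {C} {δ} a≤B d≤C ab cd = begin
  ∣ a ℚ.* c ℚ.- b ℚ.* d ∣
    ≡⟨ cong ∣_∣ (*-difference a b c d) ⟩
  ∣ a ℚ.* (c ℚ.- d) ℚ.+ d ℚ.* (a ℚ.- b) ∣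
    ≤⟨ ℚ.∣p+q∣≤∣p∣+∣q∣ (a ℚ.* (c ℚ.- d)) (d ℚ.* (a ℚ.- b)) ⟩
  ∣ a ℚ.* (c ℚ.- d) ∣ ℚ.+ ∣ d ℚ.* (a ℚ.- b) ∣
    ≤⟨ ℚ.+-mono-≤ (*-mono-∣∣ a (c ℚ.- d) a≤B cd)
                  (*-mono-∣∣ d (a ℚ.- b) d≤C ab) ⟩
  B ℚ.* δ ℚ.+ C ℚ.* δ
    ≡⟨ sym (ℚ.*-distribʳ-+ δ B C) ⟩
  (B ℚ.+ C) ℚ.* δ ∎
  where open ℚ.≤-Reasoning

*-cauchy : ∀ x y → IsCauchy x → IsCauchy y → IsCauchy λ n → x n ℚ.* y n
*-cauchy x y cx cy ε 0<ε =
  let B , 0<B , N₁ , bx = bounded x cx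
      C , 0<C , N₂ , by = bounded y cy
      δ , 0<δ , eq = quotient (B ℚ.+ C) ε (ℚ.+-mono-< 0<B 0<C) 0<ε
      N₃ , px = cx δ 0<δ
      N₄ , py = cy δ 0<δ
  in (N₁ ⊔ N₂) ⊔ (N₃ ⊔ N₄) , λ m n l k →
  let l₁₂ = ℕ.m⊔n≤o⇒m≤o (N₁ ⊔ N₂) (N₃ ⊔ N₄) l
      l₃₄ = ℕ.m⊔n≤o⇒n≤o (N₁ ⊔ N₂) (N₃ ⊔ N₄) l
      k₁₂ = ℕ.m⊔n≤o⇒m≤o (N₁ ⊔ N₂) (N₃ ⊔ N₄) k
      k₃₄ = ℕ.m⊔n≤o⇒n≤o (N₁ ⊔ N₂) (N₃ ⊔ N₄) k
  in subst (∣ x m ℚ.* y m ℚ.- x n ℚ.* y n ∣ ℚ.≤_) eq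
       (*-estimate (x m) (x n) (y m) (y n) {B} {C} {δ}
         (bx m (ℕ.m⊔n≤o⇒m≤o N₁ N₂ l₁₂)) (by n (ℕ.m⊔n≤o⇒n≤o N₁ N₂ k₁₂))
         (px m n (ℕ.m⊔n≤o⇒m≤o N₃ N₄ l₃₄) (ℕ.m⊔n≤o⇒m≤o N₃ N₄ k₃₄))
         (py m n (ℕ.m⊔n≤o⇒n≤o N₃ N₄ l₃₄) (ℕ.m⊔n≤o⇒n≤o N₃ N₄ k₃₄)))

fromℚ : ℚ → ℝ
seq    (fromℚ q) _     = q
cauchy (fromℚ q) ε 0<ε = 0 , λ _ _ _ _ →
  subst (λ r → ∣ r ∣ ℚ.≤ ε) (sym (ℚ.+-inverseʳ q)) (ℚ.<⇒≤ 0<ε)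

fromℤ : ℤ → ℝ
fromℤ z = fromℚ (z ℚ./ 1)

0ℝ 1ℝ : ℝ
0ℝ = fromℚ 0ℚ
1ℝ = fromℚ 1ℚ

-ℝ_ : ℝ → ℝ
seq    (-ℝ x) n = ℚ.- seq x n
cauchy (-ℝ x)   = neg-cauchy (seq x) (cauchy x)

_+_ _-_ _*_ : ℝ → ℝ → ℝ

seq    (x + y) n = seq x n ℚ.+ seq y n
cauchy (x + y)   = +-cauchy (seq x) (seq y) (cauchy x) (cauchy y)

x - y = x + (-ℝ y)

seq    (x * y) n = seq x n ℚ.* seq y n
cauchy (x * y)   = *-cauchy (seq x) (seq y) (cauchy x) (cauchy y)

IsLeast IsGreatest : Pred ℝ 0ℓ → ℝ → Set
IsLeast    Q l = Q l × (∀ {r} → Q r → l ≤ r)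
IsGreatest Q l = Q l × (∀ {r} → Q r → r ≤ l)

------------------------------------------------------------------------
-- Vectors and integer matrices

∑ : ∀ {n} → Vector ℝ n → ℝ
∑ = foldr _+_ 0ℝ

∑ᶻ : ∀ {n} → Vector ℤ n → ℤ
∑ᶻ = foldr ℤ._+_ (+ 0)

ℤ^ ℝ^ : ℕ → Set
ℤ^ = Vector ℤ
ℝ^ = Vector ℝ

infix  4 _≋_
infixl 6 _⊕_
infixr 7 _•_

_≋_ : ∀ {d} → ℝ^ d → ℝ^ d → Set
x ≋ y = ∀ i → x i ≈ y i

_⊕_ : ∀ {d} → ℝ^ d → ℝ^ d → ℝ^ d
(x ⊕ y) i = x i + y i

_•_ : ∀ {d} → ℝ → ℝ^ d → ℝ^ d
(t • x) i = t * x i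

⟨_,_⟩ : ∀ {d} → ℝ^ d → ℝ^ d → ℝ
⟨ h , x ⟩ = ∑ λ i → h i * x i

ι : ∀ {d} → ℤ^ d → ℝ^ d
ι v i = fromℤ (v i)

infixl 6 _+ᶻ_ _-ᶻ_
infixr 7 _•ᶻ_

_+ᶻ_ _-ᶻ_ : ∀ {d} → ℤ^ d → ℤ^ d → ℤ^ d
(v +ᶻ w) i = v i ℤ.+ w i
(v -ᶻ w) i = v i ℤ.- w i

_•ᶻ_ : ∀ {d} → ℤ → ℤ^ d → ℤ^ d
(m •ᶻ v) i = m ℤ.* v i

δ : ∀ {d} → Fin d → ℤ^ d
δ Fin.zero    Fin.zero    = + 1
δ Fin.zero    (Fin.suc j) = + 0
δ (Fin.suc i) Fin.zero    = + 0
δ (Fin.suc i) (Fin.suc j) = δ i j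

-- A matrix is the vector of its rows.
Matrix : ℕ → Set
Matrix d = Vector (ℤ^ d) d

_·_ : ∀ {d} → Matrix d → Matrix d → Matrix d
(A · B) i k = ∑ᶻ λ j → A i j ℤ.* B j k

GL : ∀ d → Pred (Matrix d) 0ℓ
GL d A = ∃ λ B → (∀ i → (A · B) i ≗ δ i) × (∀ i → (B · A) i ≗ δ i)

SignDiagonal : ∀ d → Pred (Matrix d) 0ℓ
SignDiagonal d A =
  (∀ i → A i i ≡ + 1 ⊎ A i i ≡ - + 1) × (∀ i j → i ≢ j → A i j ≡ + 0)

IsBasis : ∀ {d} → Vector (ℤ^ d) d → Set
IsBasis {d} b = ∀ (v : ℤ^ d) →
  ∃! _≗_ λ (c : ℤ^ d) → (λ j → ∑ᶻ λ i → c i ℤ.* b i j) ≗ v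

linear : ∀ {d} → Matrix d → ℝ^ d → ℝ^ d
linear A x i = ⟨ ι (A i) , x ⟩

affine : ∀ {d} → Matrix d → ℤ^ d → ℝ^ d → ℝ^ d
affine A h x = linear A x ⊕ ι h

------------------------------------------------------------------------
-- Polytopes

Region : ℕ → Set₁
Region d = Pred (ℝ^ d) 0ℓ

image : ∀ {d} → (ℝ^ d → ℝ^ d) → Region d → Region d
image f S y = ∃ λ x → S x × y ≋ f x

conv : ∀ {d n} → Vector (ℝ^ d) n → Region d
conv {d} {n} v x = ∃ λ (c : Vector ℝ n) →
  (∀ i → 0ℝ ≤ c i) × ∑ c ≈ 1ℝ × x ≋ (λ j → ∑ λ i → c i * v i j)

IsPolytope : ∀ {d} → Region d → Set
IsPolytope {d} S = ∃ λ n → ∃ λ (v : Vector (ℝ^ d) n) → S ≐ conv v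

-- Vertices are extreme points: no proper convex combination of two
-- distinct points of S.
IsVertex : ∀ {d} → Region d → ℝ^ d → Set
IsVertex S x = S x × (∀ a b t → S a → S b → 0ℝ < t → t < 1ℝ →
  x ≋ ((1ℝ - t) • a) ⊕ (t • b) → a ≋ b)

IsLatticePolytope : ∀ {d} → Region d → Set
IsLatticePolytope S =
  IsPolytope S × (∀ x → IsVertex S x → ∃ λ v → x ≋ ι v)

Δ : ∀ d → Region d
Δ d = conv ((λ _ → 0ℝ) ∷ λ i → ι (δ i))

------------------------------------------------------------------------
-- Widths and lattice sizes.  These are minima and maxima, whose values
-- are given as relations: a real is not computable from an arbitrary
-- region.

HasWidth : ∀ {d} → Region d → ℝ^ d → ℝ → Set
HasWidth S h w = ∃ λ M → ∃ λ m →
  IsGreatest Values M × IsLeast Values m × w ≈ M - m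
  where
  Values : Pred ℝ 0ℓ
  Values r = ∃ λ x → S x × r ≈ ⟨ h , x ⟩

-- gcd 0 0 ≡ 0, so a primitive vector is nonzero.
Primitive : ∀ {d} → ℤ^ d → Set
Primitive h = foldr gcd (+ 0) h ≡ + 1

HasLatticeWidth : ∀ {d} → Region d → ℝ → Set
HasLatticeWidth S =
  IsLeast λ w → ∃ λ h → Primitive h × HasWidth S (ι h) w

-- Some x ↦ A x + h with A in G maps S into l Δ.
FitsIn : ∀ {d} → Pred (Matrix d) 0ℓ → Region d → Pred ℝ 0ℓ
FitsIn {d} G S l = 0ℝ ≤ l × ∃ λ A → ∃ λ h →
  G A × image (affine A h) S ⊆ image (l •_) (Δ d)

HasLatticeSize HasNaiveLatticeSize : ∀ {d} → Region d → ℝ → Set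
HasLatticeSize      {d} S = IsLeast (FitsIn (GL d) S)
HasNaiveLatticeSize {d} S = IsLeast (FitsIn (SignDiagonal d) S)

-- The rows of the matrix A of the basis b are the vectors of b, so A is
-- b itself; the two lattice sizes have the common value l.
ComputesLatticeSize : ∀ {d} → Region d → Vector (ℤ^ d) d → Set
ComputesLatticeSize S b =
  ∃ λ l → HasLatticeSize S l × HasNaiveLatticeSize (image (linear b) S) l

-- ‖ h ‖ ≤ ‖ k ‖, where ‖_‖ is the width of S.  When S is the
-- convex hull of a nonempty finite set of lattice points, the widths
-- in integral directions exist and are unique up to _≈_, so the
-- universal quantification over their values is not vacuous.
NormLe : ∀ {d} → Region d → ℤ^ d → ℤ^ d → Set
NormLe S h k = ∀ {w w′} → HasWidth S (ι h) w → HasWidth S (ι k) w′ → w ≤ w′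

record IsReduced (S : Region 3) (h₁ h₂ h₃ : ℤ^ 3) : Set where
  field
    ‖h₁‖≤‖h₂‖          : NormLe S h₁ h₂
    ‖h₂‖≤‖h₃‖          : NormLe S h₂ h₃
    ‖h₂‖≤‖h₁+h₂‖       : NormLe S h₂ (h₁ +ᶻ h₂)
    ‖h₂‖≤‖h₁-h₂‖       : NormLe S h₂ (h₁ -ᶻ h₂)
    ‖h₃‖≤‖mh₁+nh₂+h₃‖  : ∀ m n → NormLe S h₃ (m •ᶻ h₁ +ᶻ n •ᶻ h₂ +ᶻ h₃)

points : Vector (ℤ^ 3) 6
points = (+ 0 ∷ + 2   ∷ + 5   ∷ [])
       ∷ (+ 0 ∷ - + 2 ∷ + 5   ∷ [])
       ∷ (+ 0 ∷ + 1   ∷ - + 6 ∷ [])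
       ∷ (+ 1 ∷ - + 8 ∷ + 5   ∷ [])
       ∷ (+ 1 ∷ + 2   ∷ - + 5 ∷ [])
       ∷ (+ 1 ∷ - + 4 ∷ - + 3 ∷ [])
       ∷ []

P : Region 3
P = conv λ i → ι (points i)

{-# OPTIONS --safe #-}

-- Why no reduced basis computes the lattice size of P.  The rows
-- (-10,-1,-1), (0,-1,0), (1,0,0) map P into a translate of 13Δ.  On the
-- other hand the unit vectors, a basis of ℤ³, have norm at most 11, and
-- some unit vector has an odd coordinate with respect to h₃; dividing
-- the other two coordinates by it with remainder bounds ‖h₃‖ by the norm
-- of that unit vector.  Hence a reduced basis consists of vectors of
-- norm at most 11.  Finitely many vectors are that short, and any two of
-- them, one involving e₂ and the other e₃, already need a simplex of
-- size 14.

module Submission where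

open import Algebra.Bundles using (CommutativeRing)
import Algebra.Properties.Ring as RingProperties
import Algebra.Properties.Semiring.Sum as Sum
open import Data.Fin.Base using (Fin; zero; suc; punchIn; punchOut)
import Data.Fin.Properties as Fin
open import Data.Integer.Base as ℤ using (ℤ; +_; -[1+_]; _⊓_)
open import Data.Integer.DivMod using (_%ℕ_; _/ℕ_; a≡a%ℕn+[a/ℕn]*n; n%ℕd<d)
import Data.Integer.Divisibility.Signed as Signed
open import Data.Integer.GCD using (gcd)
import Data.Integer.Properties as ℤ
open import Data.Integer.Tactic.RingSolver using (solve-∀)
open import Data.List.Base as List using (List; upTo; cartesianProduct; filter)
open import Data.List.Membership.Propositional using (_∈_)
open import Data.List.Membership.Propositional.Properties
  using (∈-cartesianProduct⁺; ∈-filter⁺; ∈-map⁺; ∈-upTo⁺)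
open import Data.List.Relation.Unary.All as All using (All)
open import Data.Nat.Base as ℕ using (ℕ; _⊔_; zero; suc)
import Data.Nat.Properties as ℕ
open import Data.Product.Base using (Σ; ∃; _×_; _,_; proj₁; proj₂; map)
open import Data.Product.Properties using (≡-dec)
open import Data.Rational.Base as ℚ using (ℚ; 0ℚ; 1ℚ; ½; ∣_∣)
import Data.Rational.Properties as ℚ
open import Data.Rational.Solver using (module +-*-Solver)
import Data.Rational.Unnormalised.Base as ℚᵘ
import Data.Rational.Unnormalised.Properties as ℚᵘ
open import Data.Sum.Base using (_⊎_; inj₁; inj₂; [_,_]′)
open import Data.Vec.Functional using (Vector; []; _∷_; foldr; removeAt; replicate)
open import Defs
open import Algebra.Structures {A = ℝ} _≈_ using (IsCommutativeRing)
open import Function.Base using (id; _∘_)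
open import Level using (0ℓ)
open import Relation.Binary.Bundles using (Preorder)
open import Relation.Binary.PropositionalEquality
  using (_≡_; _≢_; _≗_; refl; sym; trans; cong; cong₂; subst; subst₂; module ≡-Reasoning)
import Relation.Binary.Reasoning.Preorder as PreorderReasoning
import Relation.Binary.Reasoning.Setoid as SetoidReasoning
open import Relation.Nullary.Decidable using (Dec; yes; no; from-yes; map′; ¬?; _×-dec_; _⊎-dec_)
open import Relation.Nullary.Negation.Core using (¬_; contradiction)
open +-*-Solver using (solve; _:+_; _:*_; :-_; _:=_; con)

-- Parity is what makes the bound on ‖h₃‖ exact. If a unit vector e equals a h₁ + b h₂ ± (2q+1) h₃,
-- the remainders of a and b can be taken in [-q, q], so (2q+1) ‖h₃‖ ≤ ‖e‖ + q ‖h₁‖ + q ‖h₂‖ ≤ ‖e‖ +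
-- 2q ‖h₃‖, and one copy of ‖h₃‖ survives. For an even coefficient 2q the remainders reach q and the
-- same inequality is void.
--
-- The row (-10,-1,-1) has norm 12, just above the bound 11, and involves both e₂ and e₃. No vector
-- of norm at most 11 involves both, so a reduced basis contains two different rows, one with e₂ and
-- one with e₃. At some generator of P the two simplex coordinates they give already add up to 14;
-- the third coordinate is nonnegative and cannot help.
--
-- The order of Cauchy reals is undecidable. Containments and widths are therefore tested at the
-- generators, where they become decidable integer inequalities, and the description of the vertices
-- of P works with a rational lower bound of a positive weight instead of the weight itself.

infixr 4 _∩_

_∩_ : ∀ {Q R} → Eventually Q → Eventually R → Eventually λ n → Q n × R n
(M , p) ∩ (N , q) = M ⊔ N , λ n l →
  p n (ℕ.m⊔n≤o⇒m≤o M N l) , q n (ℕ.m⊔n≤o⇒n≤o M N l)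

Eventually-map : ∀ {Q R} → (∀ n → Q n → R n) → Eventually Q → Eventually R
Eventually-map f (N , p) = N , λ n l → f n (p n l)

-- Inequalities between rationals

p≤p+q : ∀ {p q} → 0ℚ ℚ.≤ q → p ℚ.≤ p ℚ.+ q
p≤p+q {p} {q} 0≤q = ℚ.≤-trans (ℚ.≤-reflexive (sym (ℚ.+-identityʳ p))) (ℚ.+-monoʳ-≤ p 0≤q)

p<q⇒0<q-p : ∀ {p q} → p ℚ.< q → 0ℚ ℚ.< q ℚ.- p
p<q⇒0<q-p {p} {q} p<q =
  ℚ.≤-<-trans (ℚ.≤-reflexive (sym (ℚ.+-inverseʳ p))) (ℚ.+-monoˡ-< (ℚ.- p) p<q)

p-q≤r⇒p≤q+r : ∀ p q {r} → p ℚ.- q ℚ.≤ r → p ℚ.≤ q ℚ.+ r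
p-q≤r⇒p≤q+r p q le = ℚ.≤-trans
  (ℚ.≤-reflexive (solve 2 (λ p q → p := q :+ (p :+ (:- q))) refl p q)) (ℚ.+-monoʳ-≤ q le)

p≤q+r⇒p-q≤r : ∀ p q r → p ℚ.≤ q ℚ.+ r → p ℚ.- q ℚ.≤ r
p≤q+r⇒p-q≤r p q r le = ℚ.≤-trans (ℚ.+-monoˡ-≤ (ℚ.- q) le)
  (ℚ.≤-reflexive (solve 2 (λ q r → (q :+ r) :+ (:- q) := r) refl q r))

p≤∣p∣ : ∀ p → p ℚ.≤ ∣ p ∣
p≤∣p∣ p with ℚ.≤-total 0ℚ p
... | inj₁ 0≤p = ℚ.≤-reflexive (sym (ℚ.0≤p⇒∣p∣≡p 0≤p))
... | inj₂ p≤0 = ℚ.≤-trans p≤0 (ℚ.0≤∣p∣ p)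

∣p∣-least : ∀ p {q} → p ℚ.≤ q → ℚ.- p ℚ.≤ q → ∣ p ∣ ℚ.≤ q
∣p∣-least p {q} p≤q -p≤q with ℚ.∣p∣≡p∨∣p∣≡-p p
... | inj₁ eq = subst (ℚ._≤ q) (sym eq) p≤q
... | inj₂ eq = subst (ℚ._≤ q) (sym eq) -p≤q

∣p-q∣-comm : ∀ p q → ∣ p ℚ.- q ∣ ≡ ∣ q ℚ.- p ∣
∣p-q∣-comm p q = trans (sym (ℚ.∣-p∣≡∣p∣ (p ℚ.- q)))
  (cong ∣_∣ (solve 2 (λ p q → :- (p :+ (:- q)) := q :+ (:- p)) refl p q))

-- The order of the reals

≤-pointwise : ∀ {x y} → (∀ n → seq x n ℚ.≤ seq y n) → x ≤ y
≤-pointwise p = mk≤ λ ε 0<ε → 0 , λ n _ → ℚ.≤-trans (p n) (p≤p+q (ℚ.<⇒≤ 0<ε))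

≈-pointwise : ∀ {x y} → (∀ n → seq x n ≡ seq y n) → x ≈ y
≈-pointwise p = ≤-pointwise (λ n → ℚ.≤-reflexive (p n))
              , ≤-pointwise (λ n → ℚ.≤-reflexive (sym (p n)))

≤-refl : ∀ {x} → x ≤ x
≤-refl = ≤-pointwise λ _ → ℚ.≤-refl

≤-trans : ∀ {x y z} → x ≤ y → y ≤ z → x ≤ z
≤-trans {x} {y} {z} x≤y y≤z = mk≤ λ ε 0<ε →
  Eventually-map
    (λ n (p , q) → begin
      seq x n                                   ≤⟨ p ⟩
      seq y n ℚ.+ ε ℚ.* ½                       ≤⟨ ℚ.+-monoˡ-≤ (ε ℚ.* ½) q ⟩
      seq z n ℚ.+ ε ℚ.* ½ ℚ.+ ε ℚ.* ½           ≡⟨ ℚ.+-assoc (seq z n) _ _ ⟩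
      seq z n ℚ.+ (ε ℚ.* ½ ℚ.+ ε ℚ.* ½)         ≡⟨ cong (seq z n ℚ.+_) (halves ε) ⟩
      seq z n ℚ.+ ε                             ∎)
    (eventually-≤ x≤y _ (half ε 0<ε) ∩ eventually-≤ y≤z _ (half ε 0<ε))
  where open ℚ.≤-Reasoning

≈-refl : ∀ {x} → x ≈ x
≈-refl = ≤-refl , ≤-refl

≈-sym : ∀ {x y} → x ≈ y → y ≈ x
≈-sym (p , q) = q , p

≈-trans : ∀ {x y z} → x ≈ y → y ≈ z → x ≈ z
≈-trans (p , q) (r , s) = ≤-trans p r , ≤-trans s q

≤-preorder : Preorder 0ℓ 0ℓ 0ℓ
≤-preorder = record
  { Carrier    = ℝ
  ; _≈_        = _≈_
  ; _≲_        = _≤_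
  ; isPreorder = record
    { isEquivalence = record { refl = ≈-refl ; sym = ≈-sym ; trans = ≈-trans }
    ; reflexive     = proj₁
    ; trans         = ≤-trans
    }
  }

+-mono-≤ : ∀ {x x′ y y′} → x ≤ x′ → y ≤ y′ → x + y ≤ x′ + y′
+-mono-≤ {x} {x′} {y} {y′} x≤x′ y≤y′ = mk≤ λ ε 0<ε →
  Eventually-map
    (λ n (p , q) → begin
      seq x n ℚ.+ seq y n
        ≤⟨ ℚ.+-mono-≤ p q ⟩
      (seq x′ n ℚ.+ ε ℚ.* ½) ℚ.+ (seq y′ n ℚ.+ ε ℚ.* ½)
        ≡⟨ solve 3 (λ a b e → (a :+ e) :+ (b :+ e) := a :+ b :+ (e :+ e)) refl
             (seq x′ n) (seq y′ n) (ε ℚ.* ½) ⟩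
      seq x′ n ℚ.+ seq y′ n ℚ.+ (ε ℚ.* ½ ℚ.+ ε ℚ.* ½)
        ≡⟨ cong (seq x′ n ℚ.+ seq y′ n ℚ.+_) (halves ε) ⟩
      seq x′ n ℚ.+ seq y′ n ℚ.+ ε ∎)
    (eventually-≤ x≤x′ _ (half ε 0<ε) ∩ eventually-≤ y≤y′ _ (half ε 0<ε))
  where open ℚ.≤-Reasoning

-‿anti-≤ : ∀ {x y} → x ≤ y → -ℝ y ≤ -ℝ x
-‿anti-≤ {x} {y} x≤y = mk≤ λ ε 0<ε → Eventually-map
  (λ n p → p-q≤r⇒p≤q+r (ℚ.- seq y n) (ℚ.- seq x n) (begin
    ℚ.- seq y n ℚ.- ℚ.- seq x n
      ≡⟨ solve 2 (λ a b → :- b :+ (:- (:- a)) := a :+ (:- b)) refl (seq x n) (seq y n) ⟩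
    seq x n ℚ.- seq y n
      ≤⟨ p≤q+r⇒p-q≤r (seq x n) (seq y n) ε p ⟩
    ε ∎))
  (eventually-≤ x≤y ε 0<ε)
  where open ℚ.≤-Reasoning

-- Products are estimated through absolute values of differences; this and its converse translate
-- the two one-sided conditions of `_≈_` into that form.
≈⇒close : ∀ {x y} → x ≈ y → ∀ ε → 0ℚ ℚ.< ε → Eventually λ n → ∣ seq x n ℚ.- seq y n ∣ ℚ.≤ ε
≈⇒close {x} {y} (x≤y , y≤x) ε 0<ε = Eventually-map
  (λ n (p , q) → ∣p∣-least (seq x n ℚ.- seq y n)
    (p≤q+r⇒p-q≤r (seq x n) (seq y n) ε p)
    (ℚ.≤-trans
      (ℚ.≤-reflexive (solve 2 (λ a b → :- (a :+ (:- b)) := b :+ (:- a)) refl (seq x n) (seq y n)))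
      (p≤q+r⇒p-q≤r (seq y n) (seq x n) ε q)))
  (eventually-≤ x≤y ε 0<ε ∩ eventually-≤ y≤x ε 0<ε)

close⇒≈ : ∀ {x y} → (∀ ε → 0ℚ ℚ.< ε → Eventually λ n → ∣ seq x n ℚ.- seq y n ∣ ℚ.≤ ε) → x ≈ y
close⇒≈ {x} {y} c =
    mk≤ (λ ε 0<ε → Eventually-map (λ n p →
      p-q≤r⇒p≤q+r (seq x n) (seq y n) (ℚ.≤-trans (p≤∣p∣ _) p)) (c ε 0<ε))
  , mk≤ (λ ε 0<ε → Eventually-map (λ n p →
      p-q≤r⇒p≤q+r (seq y n) (seq x n)
        (ℚ.≤-trans (p≤∣p∣ _) (subst (ℚ._≤ ε) (∣p-q∣-comm (seq x n) (seq y n)) p))) (c ε 0<ε))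

*-cong : ∀ {x x′ y y′} → x ≈ x′ → y ≈ y′ → x * y ≈ x′ * y′
*-cong {x} {x′} {y} {y′} x≈x′ y≈y′ = close⇒≈ λ ε 0<ε →
  let B , 0<B , bx = bounded (seq x) (cauchy x)
      C , 0<C , by = bounded (seq y′) (cauchy y′)
      δ , 0<δ , eq = quotient (B ℚ.+ C) ε (ℚ.+-mono-< 0<B 0<C) 0<ε
  in Eventually-map
    (λ n (p , q , r , s) →
      subst (∣ seq x n ℚ.* seq y n ℚ.- seq x′ n ℚ.* seq y′ n ∣ ℚ.≤_) eq
        (*-estimate (seq x n) (seq x′ n) (seq y n) (seq y′ n) p q r s))
    (bx ∩ by ∩ ≈⇒close x≈x′ δ 0<δ ∩ ≈⇒close y≈y′ δ 0<δ)

-- A nonnegative real may have slightly negative approximations. If one factor is nonnegative, the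
-- defect d of the other costs at most B d; if both are negative, the product is already
-- nonnegative.
*-almost-nonNeg : ∀ p q {d B} → 0ℚ ℚ.≤ d → 0ℚ ℚ.≤ p ℚ.+ d → 0ℚ ℚ.≤ q ℚ.+ d →
  ∣ p ∣ ℚ.≤ B → ∣ q ∣ ℚ.≤ B → 0ℚ ℚ.≤ p ℚ.* q ℚ.+ B ℚ.* d
*-almost-nonNeg p q {d} {B} 0≤d 0≤p+d 0≤q+d p≤B q≤B with ℚ.≤-total 0ℚ p | ℚ.≤-total 0ℚ q
... | inj₁ 0≤p | _ = begin
  0ℚ                              ≡⟨ ℚ.*-zeroʳ p ⟨
  p ℚ.* 0ℚ                        ≤⟨ ℚ.*-monoˡ-≤-nonNeg p {{ℚ.nonNegative 0≤p}} 0≤q+d ⟩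
  p ℚ.* (q ℚ.+ d)                 ≡⟨ ℚ.*-distribˡ-+ p q d ⟩
  p ℚ.* q ℚ.+ p ℚ.* d             ≤⟨ ℚ.+-monoʳ-≤ (p ℚ.* q)
                                       (ℚ.*-monoʳ-≤-nonNeg d {{ℚ.nonNegative 0≤d}} (ℚ.≤-trans (p≤∣p∣ p) p≤B)) ⟩
  p ℚ.* q ℚ.+ B ℚ.* d             ∎
  where open ℚ.≤-Reasoning
... | inj₂ _ | inj₁ 0≤q = begin
  0ℚ                              ≡⟨ ℚ.*-zeroˡ q ⟨
  0ℚ ℚ.* q                        ≤⟨ ℚ.*-monoʳ-≤-nonNeg q {{ℚ.nonNegative 0≤q}} 0≤p+d ⟩
  (p ℚ.+ d) ℚ.* q                 ≡⟨ solve 3 (λ p q d → (p :+ d) :* q := p :* q :+ q :* d) refl p q d ⟩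
  p ℚ.* q ℚ.+ q ℚ.* d             ≤⟨ ℚ.+-monoʳ-≤ (p ℚ.* q)
                                       (ℚ.*-monoʳ-≤-nonNeg d {{ℚ.nonNegative 0≤d}} (ℚ.≤-trans (p≤∣p∣ q) q≤B)) ⟩
  p ℚ.* q ℚ.+ B ℚ.* d             ∎
  where open ℚ.≤-Reasoning
... | inj₂ p≤0 | inj₂ q≤0 = begin
  0ℚ                              ≡⟨ ℚ.*-zeroʳ p ⟨
  p ℚ.* 0ℚ                        ≤⟨ ℚ.*-monoˡ-≤-nonPos p {{ℚ.nonPositive p≤0}} q≤0 ⟩
  p ℚ.* q                         ≤⟨ p≤p+q (ℚ.≤-trans (ℚ.≤-reflexive (sym (ℚ.*-zeroʳ B)))
                                       (ℚ.*-monoˡ-≤-nonNeg B {{ℚ.nonNegative (ℚ.≤-trans (ℚ.0≤∣p∣ p) p≤B)}} 0≤d)) ⟩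
  p ℚ.* q ℚ.+ B ℚ.* d             ∎
  where open ℚ.≤-Reasoning

*-nonNeg : ∀ {x y} → 0ℝ ≤ x → 0ℝ ≤ y → 0ℝ ≤ x * y
*-nonNeg {x} {y} 0≤x 0≤y = mk≤ λ ε 0<ε →
  let B , 0<B , bx = bounded (seq x) (cauchy x)
      C , 0<C , by = bounded (seq y) (cauchy y)
      d , 0<d , eq = quotient (B ℚ.+ C) ε (ℚ.+-mono-< 0<B 0<C) 0<ε
  in Eventually-map
    (λ n (p , q , r , s) →
      subst (λ e → 0ℚ ℚ.≤ seq x n ℚ.* seq y n ℚ.+ e) eq
        (*-almost-nonNeg (seq x n) (seq y n) (ℚ.<⇒≤ 0<d) p q
          (ℚ.≤-trans r (p≤p+q (ℚ.<⇒≤ 0<C)))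
          (ℚ.≤-trans s (ℚ.≤-trans (p≤p+q (ℚ.<⇒≤ 0<B)) (ℚ.≤-reflexive (ℚ.+-comm C B))))))
    (eventually-≤ 0≤x d 0<d ∩ eventually-≤ 0≤y d 0<d ∩ bx ∩ by)

+-*-isCommutativeRing : IsCommutativeRing _+_ _*_ -ℝ_ 0ℝ 1ℝ
+-*-isCommutativeRing = record
  { isRing = record
    { +-isAbelianGroup = record
      { isGroup = record
        { isMonoid = record
          { isSemigroup = record
            { isMagma = record
              { isEquivalence = Preorder.isEquivalence ≤-preorder
              ; ∙-cong        = λ (p , q) (r , s) → +-mono-≤ p r , +-mono-≤ q s
              }
            ; assoc = λ x y z → ≈-pointwise λ n → ℚ.+-assoc (seq x n) (seq y n) (seq z n)
            }
          ; identity = (λ x → ≈-pointwise λ n → ℚ.+-identityˡ (seq x n))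
                     , (λ x → ≈-pointwise λ n → ℚ.+-identityʳ (seq x n))
          }
        ; inverse = (λ x → ≈-pointwise λ n → ℚ.+-inverseˡ (seq x n))
                  , (λ x → ≈-pointwise λ n → ℚ.+-inverseʳ (seq x n))
        ; ⁻¹-cong = λ (p , q) → -‿anti-≤ q , -‿anti-≤ p
        }
      ; comm = λ x y → ≈-pointwise λ n → ℚ.+-comm (seq x n) (seq y n)
      }
    ; *-cong     = *-cong
    ; *-assoc    = λ x y z → ≈-pointwise λ n → ℚ.*-assoc (seq x n) (seq y n) (seq z n)
    ; *-identity = (λ x → ≈-pointwise λ n → ℚ.*-identityˡ (seq x n))
                 , (λ x → ≈-pointwise λ n → ℚ.*-identityʳ (seq x n))
    ; distrib    = (λ x y z → ≈-pointwise λ n → ℚ.*-distribˡ-+ (seq x n) (seq y n) (seq z n))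
                 , (λ x y z → ≈-pointwise λ n → ℚ.*-distribʳ-+ (seq x n) (seq y n) (seq z n))
    }
  ; *-comm = λ x y → ≈-pointwise λ n → ℚ.*-comm (seq x n) (seq y n)
  }

+-*-commutativeRing : CommutativeRing 0ℓ 0ℓ
+-*-commutativeRing = record { isCommutativeRing = +-*-isCommutativeRing }

x≤y⇒0≤y-x : ∀ {x y} → x ≤ y → 0ℝ ≤ y - x
x≤y⇒0≤y-x {x} {y} x≤y = ≤-trans
  (proj₂ (CommutativeRing.-‿inverseʳ +-*-commutativeRing x))
  (+-mono-≤ x≤y ≤-refl)

0≤y-x⇒x≤y : ∀ {x y} → 0ℝ ≤ y - x → x ≤ y
0≤y-x⇒x≤y {x} {y} 0≤y-x = ≤-trans
  (proj₂ (CommutativeRing.+-identityˡ +-*-commutativeRing x))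
  (≤-trans (+-mono-≤ 0≤y-x ≤-refl) (proj₁ (≈-pointwise λ n →
    solve 2 (λ x y → y :+ (:- x) :+ x := y) refl (seq x n) (seq y n))))

*-monoˡ-≤ : ∀ {x y z} → 0ℝ ≤ z → x ≤ y → z * x ≤ z * y
*-monoˡ-≤ {x} {y} {z} 0≤z x≤y = 0≤y-x⇒x≤y (≤-trans
  (*-nonNeg 0≤z (x≤y⇒0≤y-x x≤y))
  (proj₁ (≈-pointwise λ n →
    solve 3 (λ x y z → z :* (y :+ (:- x)) := z :* y :+ (:- (z :* x))) refl
      (seq x n) (seq y n) (seq z n))))

-- Constructively, a positive sum has a positive summand because a
-- rational approximation decides which one.
0<x+y⇒0<x⊎0<y : ∀ {x y} → 0ℝ < x + y → 0ℝ < x ⊎ 0ℝ < y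
0<x+y⇒0<x⊎0<y {x} {y} (mk< g 0<g (N , p)) =
  decide (ℚ.≤-total (g ℚ.* ½) (seq x n₀))
  where
  open ℚ.≤-Reasoning
  -- One of the two approximations at `n₀` is at least g/2; later ones differ from it by at most g/4
  -- and so stay above g/4.
  e = g ℚ.* ½ ℚ.* ½
  0<e = half _ (half g 0<g)
  Mx = proj₁ (cauchy x e 0<e)
  My = proj₁ (cauchy y e 0<e)
  n₀ = N ⊔ (Mx ⊔ My)
  Mx≤n₀ = ℕ.≤-trans (ℕ.m≤m⊔n Mx My) (ℕ.m≤n⊔m N (Mx ⊔ My))
  My≤n₀ = ℕ.≤-trans (ℕ.m≤n⊔m Mx My) (ℕ.m≤n⊔m N (Mx ⊔ My))

  stays : ∀ a b → g ℚ.* ½ ℚ.≤ a → ∣ a ℚ.- b ∣ ℚ.≤ e → 0ℚ ℚ.+ e ℚ.≤ b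
  stays a b g/2≤a ab≤e = begin
    0ℚ ℚ.+ e                 ≡⟨ solve 1 (λ e → con 0ℚ :+ e := e :+ e :+ (:- e)) refl e ⟩
    e ℚ.+ e ℚ.- e            ≡⟨ cong (ℚ._- e) (halves (g ℚ.* ½)) ⟩
    g ℚ.* ½ ℚ.- e            ≤⟨ ℚ.+-mono-≤ g/2≤a (ℚ.neg-antimono-≤ (ℚ.≤-trans (p≤∣p∣ _) ab≤e)) ⟩
    a ℚ.- (a ℚ.- b)          ≡⟨ solve 2 (λ a b → a :+ (:- (a :+ (:- b))) := b) refl a b ⟩
    b                        ∎

  decide : g ℚ.* ½ ℚ.≤ seq x n₀ ⊎ seq x n₀ ℚ.≤ g ℚ.* ½ → 0ℝ < x ⊎ 0ℝ < y
  decide (inj₁ g/2≤x) = inj₁ (mk< e 0<e (Mx , λ n l →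
    stays (seq x n₀) (seq x n) g/2≤x (proj₂ (cauchy x e 0<e) n₀ n Mx≤n₀ l)))
  decide (inj₂ x≤g/2) = inj₂ (mk< e 0<e (My , λ n l →
    stays (seq y n₀) (seq y n) g/2≤y (proj₂ (cauchy y e 0<e) n₀ n My≤n₀ l)))
    where
    g/2≤y : g ℚ.* ½ ℚ.≤ seq y n₀
    g/2≤y = begin
      g ℚ.* ½                                 ≡⟨ solve 1 (λ h → h := con 0ℚ :+ (h :+ h) :+ (:- h)) refl (g ℚ.* ½) ⟩
      0ℚ ℚ.+ (g ℚ.* ½ ℚ.+ g ℚ.* ½) ℚ.- g ℚ.* ½ ≡⟨ cong (λ h → 0ℚ ℚ.+ h ℚ.- g ℚ.* ½) (halves g) ⟩
      0ℚ ℚ.+ g ℚ.- g ℚ.* ½                    ≤⟨ ℚ.+-mono-≤ (p n₀ (ℕ.m≤m⊔n N _)) (ℚ.neg-antimono-≤ x≤g/2) ⟩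
      seq x n₀ ℚ.+ seq y n₀ ℚ.- seq x n₀      ≡⟨ solve 2 (λ a b → a :+ b :+ (:- a) := b) refl (seq x n₀) (seq y n₀) ⟩
      seq y n₀                                ∎

fromℚ-mono-≤ : ∀ {p q} → p ℚ.≤ q → fromℚ p ≤ fromℚ q
fromℚ-mono-≤ p≤q = ≤-pointwise λ _ → p≤q

fromℚ-cancel-≤ : ∀ {p q} → fromℚ p ≤ fromℚ q → p ℚ.≤ q
fromℚ-cancel-≤ {p} {q} le with p ℚ.≤? q
... | yes p≤q = p≤q
... | no  p≰q = contradiction (ℚ.<-≤-trans 0<e e≤0) (ℚ.<-irrefl refl)
  where
  open ℚ.≤-Reasoning
  d = p ℚ.- q
  e = d ℚ.* ½
  0<e = half d (p<q⇒0<q-p (ℚ.≰⇒> p≰q))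
  ev = eventually-≤ le e 0<e
  e≤0 : e ℚ.≤ 0ℚ
  e≤0 = begin
    e                ≡⟨ solve 1 (λ e → e := e :+ e :+ (:- e)) refl e ⟩
    e ℚ.+ e ℚ.- e    ≡⟨ cong (ℚ._- e) (halves d) ⟩
    d ℚ.- e          ≤⟨ ℚ.+-monoˡ-≤ (ℚ.- e) (p≤q+r⇒p-q≤r p q e (proj₂ ev (proj₁ ev) ℕ.≤-refl)) ⟩
    e ℚ.- e          ≡⟨ ℚ.+-inverseʳ e ⟩
    0ℚ               ∎

-- Finite sums

module R where
  open CommutativeRing +-*-commutativeRing public
  open Sum semiring public
  open RingProperties ring public using (-‿distribˡ-*)

module ℤR where
  open Sum (CommutativeRing.semiring ℤ.+-*-commutativeRing) public

module _ {c ℓ} (K : CommutativeRing c ℓ) where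
  open CommutativeRing K using (Carrier; 0#; setoid; +-congˡ; +-identityʳ; semiring)
    renaming (_≈_ to _≈ᴷ_; _+_ to _+ᴷ_)
  open Sum semiring using (sum; sum-remove; sum-cong-≋; sum-replicate-zero)
  open SetoidReasoning setoid

  sum-single : ∀ {n} (f : Vector Carrier n) i → (∀ k → i ≢ k → f k ≈ᴷ 0#) → sum f ≈ᴷ f i
  sum-single {suc n} f i f≈0 = begin
    sum f                            ≈⟨ sum-remove f ⟩
    f i +ᴷ sum (removeAt f i)        ≈⟨ +-congˡ (sum-cong-≋ λ k → f≈0 (punchIn i k) (Fin.punchInᵢ≢i i k ∘ sym)) ⟩
    f i +ᴷ sum {n} (replicate n 0#)  ≈⟨ +-congˡ (sum-replicate-zero n) ⟩
    f i +ᴷ 0#                        ≈⟨ +-identityʳ (f i) ⟩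
    f i                              ∎

δ-diagonal : ∀ {d} (i : Fin d) → δ i i ≡ + 1
δ-diagonal zero    = refl
δ-diagonal (suc i) = δ-diagonal i

δ-off-diagonal : ∀ {d} {i j : Fin d} → i ≢ j → δ i j ≡ + 0
δ-off-diagonal {i = zero}  {zero}  i≢j = contradiction refl i≢j
δ-off-diagonal {i = zero}  {suc j} i≢j = refl
δ-off-diagonal {i = suc i} {zero}  i≢j = refl
δ-off-diagonal {i = suc i} {suc j} i≢j = δ-off-diagonal (i≢j ∘ cong suc)

∑ᶻ-δˡ : ∀ {d} (f : Vector ℤ d) i → (∑ᶻ λ k → δ i k ℤ.* f k) ≡ f i
∑ᶻ-δˡ f i = trans
  (sum-single ℤ.+-*-commutativeRing _ i (λ k i≢k → cong (ℤ._* f k) (δ-off-diagonal i≢k)))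
  (trans (cong (ℤ._* f i) (δ-diagonal i)) (ℤ.*-identityˡ (f i)))

-- Integers and integral vectors as reals

-- `_/_` normalises by a gcd, which blocks direct computation; among unnormalised rationals the
-- claim is an integer identity.
/1-homo-+ : ∀ a b → (a ℤ.+ b) ℚ./ 1 ≡ a ℚ./ 1 ℚ.+ b ℚ./ 1
/1-homo-+ a b = ℚ.toℚᵘ-injective (begin-equality
  ℚ.toℚᵘ ((a ℤ.+ b) ℚ./ 1)
    ≃⟨ ℚ.toℚᵘ-fromℚᵘ (ℚᵘ.mkℚᵘ (a ℤ.+ b) 0) ⟩
  ℚᵘ.mkℚᵘ (a ℤ.+ b) 0
    ≃⟨ ℚᵘ.*≡* (clear a b) ⟩
  ℚᵘ.mkℚᵘ a 0 ℚᵘ.+ ℚᵘ.mkℚᵘ b 0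
    ≃⟨ ℚᵘ.+-cong (ℚ.toℚᵘ-fromℚᵘ (ℚᵘ.mkℚᵘ a 0)) (ℚ.toℚᵘ-fromℚᵘ (ℚᵘ.mkℚᵘ b 0)) ⟨
  ℚ.toℚᵘ (a ℚ./ 1) ℚᵘ.+ ℚ.toℚᵘ (b ℚ./ 1)
    ≃⟨ ℚ.toℚᵘ-homo-+ (a ℚ./ 1) (b ℚ./ 1) ⟨
  ℚ.toℚᵘ (a ℚ./ 1 ℚ.+ b ℚ./ 1) ∎)
  where
  open ℚᵘ.≤-Reasoning
  clear : ∀ a b → (a ℤ.+ b) ℤ.* + 1 ≡ (a ℤ.* + 1 ℤ.+ b ℤ.* + 1) ℤ.* + 1
  clear = solve-∀

/1-homo-* : ∀ a b → (a ℤ.* b) ℚ./ 1 ≡ a ℚ./ 1 ℚ.* (b ℚ./ 1)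
/1-homo-* a b = ℚ.toℚᵘ-injective (begin-equality
  ℚ.toℚᵘ ((a ℤ.* b) ℚ./ 1)
    ≃⟨ ℚ.toℚᵘ-fromℚᵘ (ℚᵘ.mkℚᵘ (a ℤ.* b) 0) ⟩
  ℚᵘ.mkℚᵘ a 0 ℚᵘ.* ℚᵘ.mkℚᵘ b 0
    ≃⟨ ℚᵘ.*-cong (ℚ.toℚᵘ-fromℚᵘ (ℚᵘ.mkℚᵘ a 0)) (ℚ.toℚᵘ-fromℚᵘ (ℚᵘ.mkℚᵘ b 0)) ⟨
  ℚ.toℚᵘ (a ℚ./ 1) ℚᵘ.* ℚ.toℚᵘ (b ℚ./ 1)
    ≃⟨ ℚ.toℚᵘ-homo-* (a ℚ./ 1) (b ℚ./ 1) ⟨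
  ℚ.toℚᵘ (a ℚ./ 1 ℚ.* (b ℚ./ 1)) ∎)
  where open ℚᵘ.≤-Reasoning

/1-mono-≤ : ∀ {a b} → a ℤ.≤ b → a ℚ./ 1 ℚ.≤ b ℚ./ 1
/1-mono-≤ {a} {b} a≤b = ℚ.toℚᵘ-cancel-≤ (begin
  ℚ.toℚᵘ (a ℚ./ 1)  ≃⟨ ℚ.toℚᵘ-fromℚᵘ (ℚᵘ.mkℚᵘ a 0) ⟩
  ℚᵘ.mkℚᵘ a 0       ≤⟨ ℚᵘ.*≤* (ℤ.*-monoʳ-≤-nonNeg (+ 1) a≤b) ⟩
  ℚᵘ.mkℚᵘ b 0       ≃⟨ ℚ.toℚᵘ-fromℚᵘ (ℚᵘ.mkℚᵘ b 0) ⟨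
  ℚ.toℚᵘ (b ℚ./ 1)  ∎)
  where open ℚᵘ.≤-Reasoning

/1-cancel-≤ : ∀ {a b} → a ℚ./ 1 ℚ.≤ b ℚ./ 1 → a ℤ.≤ b
/1-cancel-≤ {a} {b} le = ℤ.*-cancelʳ-≤-pos a b (+ 1) (ℚᵘ.drop-*≤* (begin
  ℚᵘ.mkℚᵘ a 0       ≃⟨ ℚ.toℚᵘ-fromℚᵘ (ℚᵘ.mkℚᵘ a 0) ⟨
  ℚ.toℚᵘ (a ℚ./ 1)  ≤⟨ ℚ.toℚᵘ-mono-≤ le ⟩
  ℚ.toℚᵘ (b ℚ./ 1)  ≃⟨ ℚ.toℚᵘ-fromℚᵘ (ℚᵘ.mkℚᵘ b 0) ⟩
  ℚᵘ.mkℚᵘ b 0       ∎))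
  where open ℚᵘ.≤-Reasoning

fromℤ-+ : ∀ a b → fromℤ (a ℤ.+ b) ≈ fromℤ a + fromℤ b
fromℤ-+ a b = ≈-pointwise λ _ → /1-homo-+ a b

fromℤ-* : ∀ a b → fromℤ (a ℤ.* b) ≈ fromℤ a * fromℤ b
fromℤ-* a b = ≈-pointwise λ _ → /1-homo-* a b

fromℤ-neg : ∀ a → fromℤ (ℤ.- a) ≈ -ℝ (fromℤ a)
fromℤ-neg a = ≈-pointwise λ _ → begin
  (ℤ.- a) ℚ./ 1                            ≡⟨ solve 2 (λ p q → p := p :+ q :+ (:- q)) refl ((ℤ.- a) ℚ./ 1) (a ℚ./ 1) ⟩
  (ℤ.- a) ℚ./ 1 ℚ.+ a ℚ./ 1 ℚ.- a ℚ./ 1    ≡⟨ cong (ℚ._- a ℚ./ 1) (/1-homo-+ (ℤ.- a) a) ⟨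
  (ℤ.- a ℤ.+ a) ℚ./ 1 ℚ.- a ℚ./ 1          ≡⟨ cong (λ z → z ℚ./ 1 ℚ.- a ℚ./ 1) (ℤ.+-inverseˡ a) ⟩
  0ℚ ℚ.- a ℚ./ 1                           ≡⟨ ℚ.+-identityˡ _ ⟩
  ℚ.- (a ℚ./ 1)                            ∎
  where open ≡-Reasoning

fromℤ-mono-≤ : ∀ {a b} → a ℤ.≤ b → fromℤ a ≤ fromℤ b
fromℤ-mono-≤ a≤b = fromℚ-mono-≤ (/1-mono-≤ a≤b)

fromℤ-cancel-≤ : ∀ {a b} → fromℤ a ≤ fromℤ b → a ℤ.≤ b
fromℤ-cancel-≤ le = /1-cancel-≤ (fromℚ-cancel-≤ le)

fromℤ-cong : ∀ {a b} → a ≡ b → fromℤ a ≈ fromℤ b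
fromℤ-cong refl = ≈-refl

fromℤ-∑ : ∀ {n} (f : Vector ℤ n) → fromℤ (∑ᶻ f) ≈ ∑ (fromℤ ∘ f)
fromℤ-∑ {zero}  f = ≈-refl
fromℤ-∑ {suc n} f = ≈-trans (fromℤ-+ (f zero) _) (R.+-congˡ (fromℤ-∑ (f ∘ suc)))

infix 7 _∙_
_∙_ : ∀ {d} → ℤ^ d → ℤ^ d → ℤ
h ∙ v = ∑ᶻ λ i → h i ℤ.* v i

⟨ι,ι⟩ : ∀ {d} (h v : ℤ^ d) → ⟨ ι h , ι v ⟩ ≈ fromℤ (h ∙ v)
⟨ι,ι⟩ h v = ≈-sym (≈-trans (fromℤ-∑ (λ i → h i ℤ.* v i))
  (R.sum-cong-≋ λ i → fromℤ-* (h i) (v i)))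

-- Convex hulls

∑-mono-≤ : ∀ {n} {f g : Vector ℝ n} → (∀ i → f i ≤ g i) → ∑ f ≤ ∑ g
∑-mono-≤ {zero}  p = ≤-refl
∑-mono-≤ {suc n} p = +-mono-≤ (p zero) (∑-mono-≤ (p ∘ suc))

∑-δˡ : ∀ {d} (f : Vector ℝ d) i → (∑ λ k → fromℤ (δ i k) * f k) ≈ f i
∑-δˡ f i = ≈-trans
  (sum-single +-*-commutativeRing _ i λ k i≢k →
    ≈-trans (*-cong (fromℤ-cong (δ-off-diagonal i≢k)) ≈-refl) (R.zeroˡ (f k)))
  (≈-trans (*-cong (fromℤ-cong (δ-diagonal i)) ≈-refl) (R.*-identityˡ (f i)))

∑-δʳ : ∀ {d} (f : Vector ℝ d) j → (∑ λ k → f k * fromℤ (δ k j)) ≈ f j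
∑-δʳ f j = ≈-trans
  (sum-single +-*-commutativeRing _ j λ k j≢k →
    ≈-trans (*-cong ≈-refl (fromℤ-cong (δ-off-diagonal (j≢k ∘ sym)))) (R.zeroʳ (f k)))
  (≈-trans (*-cong ≈-refl (fromℤ-cong (δ-diagonal j))) (R.*-identityʳ (f j)))

0≤δ : ∀ {d} (i j : Fin d) → + 0 ℤ.≤ δ i j
0≤δ i j with i Fin.≟ j
... | yes refl = subst (+ 0 ℤ.≤_) (sym (δ-diagonal i)) (ℤ.+≤+ ℕ.z≤n)
... | no  i≢j  = subst (+ 0 ℤ.≤_) (sym (δ-off-diagonal i≢j)) ℤ.≤-refl

⟨,⟩-congʳ : ∀ {d} (h : ℝ^ d) {x y} → x ≋ y → ⟨ h , x ⟩ ≈ ⟨ h , y ⟩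
⟨,⟩-congʳ h x≋y = R.sum-cong-≋ λ i → *-cong ≈-refl (x≋y i)

⟨,⟩-∑ : ∀ {d n} (h : ℝ^ d) (c : Vector ℝ n) (v : Vector (ℝ^ d) n) →
  ⟨ h , (λ j → ∑ λ i → c i * v i j) ⟩ ≈ ∑ λ i → c i * ⟨ h , v i ⟩
⟨,⟩-∑ h c v = begin
  (∑ λ j → h j * ∑ λ i → c i * v i j)    ≈⟨ R.sum-cong-≋ (λ j → R.*-distribˡ-sum (h j) (λ i → c i * v i j)) ⟩
  (∑ λ j → ∑ λ i → h j * (c i * v i j))  ≈⟨ R.∑-comm (λ j i → h j * (c i * v i j)) ⟩
  (∑ λ i → ∑ λ j → h j * (c i * v i j))  ≈⟨ R.sum-cong-≋ (λ i → R.sum-cong-≋ λ j → swap (h j) (c i) (v i j)) ⟩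
  (∑ λ i → ∑ λ j → c i * (h j * v i j))  ≈⟨ R.sum-cong-≋ (λ i → R.*-distribˡ-sum (c i) (λ j → h j * v i j)) ⟨
  (∑ λ i → c i * ⟨ h , v i ⟩)            ∎
  where
  open SetoidReasoning R.setoid
  swap : ∀ a b c → a * (b * c) ≈ b * (a * c)
  swap a b c = ≈-pointwise λ n →
    solve 3 (λ a b c → a :* (b :* c) := b :* (a :* c)) refl (seq a n) (seq b n) (seq c n)

module _ {d n} {v : Vector (ℝ^ d) n} where
  open PreorderReasoning ≤-preorder

  conv-≤ : ∀ h {M x} → (∀ i → ⟨ h , v i ⟩ ≤ M) → conv v x → ⟨ h , x ⟩ ≤ M
  conv-≤ h {M} {x} v≤M (c , 0≤c , ∑c , x≋) = begin
    ⟨ h , x ⟩                      ≈⟨ ⟨,⟩-congʳ h x≋ ⟩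
    ⟨ h , _ ⟩                      ≈⟨ ⟨,⟩-∑ h c v ⟩
    (∑ λ i → c i * ⟨ h , v i ⟩)    ≲⟨ ∑-mono-≤ (λ i → *-monoˡ-≤ (0≤c i) (v≤M i)) ⟩
    (∑ λ i → c i * M)              ≈⟨ R.*-distribʳ-sum M c ⟨
    ∑ c * M                        ≈⟨ *-cong ∑c ≈-refl ⟩
    1ℝ * M                         ≈⟨ R.*-identityˡ M ⟩
    M                              ∎

  conv-≥ : ∀ h {m x} → (∀ i → m ≤ ⟨ h , v i ⟩) → conv v x → m ≤ ⟨ h , x ⟩
  conv-≥ h {m} {x} m≤v (c , 0≤c , ∑c , x≋) = begin
    m                              ≈⟨ R.*-identityˡ m ⟨
    1ℝ * m                         ≈⟨ *-cong ∑c ≈-refl ⟨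
    ∑ c * m                        ≈⟨ R.*-distribʳ-sum m c ⟩
    (∑ λ i → c i * m)              ≲⟨ ∑-mono-≤ (λ i → *-monoˡ-≤ (0≤c i) (m≤v i)) ⟩
    (∑ λ i → c i * ⟨ h , v i ⟩)    ≈⟨ ⟨,⟩-∑ h c v ⟨
    ⟨ h , _ ⟩                      ≈⟨ ⟨,⟩-congʳ h x≋ ⟨
    ⟨ h , x ⟩                      ∎

∑δ≈1 : ∀ {n} (i : Fin n) → (∑ λ k → fromℤ (δ i k)) ≈ 1ℝ
∑δ≈1 i = ≈-trans (R.sum-cong-≋ λ k → ≈-sym (R.*-identityʳ (fromℤ (δ i k)))) (∑-δˡ (λ _ → 1ℝ) i)

vertex∈conv : ∀ {d n} (v : Vector (ℝ^ d) n) i → conv v (v i)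
vertex∈conv v i = fromℤ ∘ δ i , (λ k → fromℤ-mono-≤ (0≤δ i k)) , ∑δ≈1 i
                , λ j → ≈-sym (∑-δˡ (λ k → v k j) i)

-- Extreme points of a convex hull

0<∑⇒∃0< : ∀ {n} (c : Vector ℝ n) → 0ℝ < ∑ c → ∃ λ i → 0ℝ < c i
0<∑⇒∃0< {zero}  c (mk< g 0<g (N , p)) =
  contradiction (ℚ.<-≤-trans 0<g (ℚ.≤-trans (ℚ.≤-reflexive (sym (ℚ.+-identityˡ g))) (p N ℕ.≤-refl))) (ℚ.<-irrefl refl)
0<∑⇒∃0< {suc n} c 0<∑ = [ (zero ,_) , (λ 0<∑′ → map suc id (0<∑⇒∃0< (c ∘ suc) 0<∑′)) ]′
  (0<x+y⇒0<x⊎0<y {c zero} {∑ (c ∘ suc)} 0<∑)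

<-≈-trans : ∀ {x y z} → x < y → y ≈ z → x < z
-- `y ≤ z` holds only up to an arbitrary ε; half of the gap is spent on it.
<-≈-trans {x} {y} {z} (mk< g 0<g ev) (y≤z , _) = mk< (g ℚ.* ½) (half g 0<g)
  (Eventually-map (λ n (p , q) → begin
    seq x n ℚ.+ g ℚ.* ½
      ≡⟨ solve 2 (λ a h → a :+ h := a :+ (h :+ h) :+ (:- h)) refl (seq x n) (g ℚ.* ½) ⟩
    seq x n ℚ.+ (g ℚ.* ½ ℚ.+ g ℚ.* ½) ℚ.- g ℚ.* ½
      ≡⟨ cong (λ h → seq x n ℚ.+ h ℚ.- g ℚ.* ½) (halves g) ⟩
    seq x n ℚ.+ g ℚ.- g ℚ.* ½
      ≤⟨ p≤q+r⇒p-q≤r _ (g ℚ.* ½) (seq z n)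
           (ℚ.≤-trans p (ℚ.≤-trans q (ℚ.≤-reflexive (ℚ.+-comm (seq z n) _)))) ⟩
    seq z n ∎)
  (ev ∩ eventually-≤ y≤z _ (half g 0<g)))
  where open ℚ.≤-Reasoning

0<1ℝ : 0ℝ < 1ℝ
0<1ℝ = mk< 1ℚ (ℚ.positive⁻¹ 1ℚ) (0 , λ _ _ → ℚ.≤-reflexive (ℚ.+-identityˡ 1ℚ))

-- The minimum with ½ keeps q below 1 without comparing the real x with 1.
positive-rational-below : ∀ {x} → 0ℝ < x → ∃ λ q → 0ℚ ℚ.< q × q ℚ.< 1ℚ × fromℚ q ≤ x
positive-rational-below {x} (mk< g 0<g g≤x) = g ℚ.⊓ ½ , 0<q (ℚ.⊓-sel g ½)
  , ℚ.≤-<-trans (ℚ.p⊓q≤q g ½) (ℚ.*<* (ℤ.+<+ (ℕ.s≤s (ℕ.s≤s ℕ.z≤n))))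
  , mk≤ λ ε 0<ε → Eventually-map
      (λ n p → ℚ.≤-trans (ℚ.p⊓q≤p g ½)
        (ℚ.≤-trans (ℚ.≤-reflexive (sym (ℚ.+-identityˡ g))) (ℚ.≤-trans p (p≤p+q (ℚ.<⇒≤ 0<ε)))))
      g≤x
  where
  0<q : g ℚ.⊓ ½ ≡ g ⊎ g ℚ.⊓ ½ ≡ ½ → 0ℚ ℚ.< g ℚ.⊓ ½
  0<q (inj₁ eq) = subst (0ℚ ℚ.<_) (sym eq) 0<g
  0<q (inj₂ eq) = subst (0ℚ ℚ.<_) (sym eq) (ℚ.positive⁻¹ ½)

-- A convex combination in which vᵢ has weight at least t is
-- (1 - t) a + t vᵢ, where a comes from lowering that weight by t and
-- rescaling by s = 1 / (1 - t).
module _ {d n} (v : Vector (ℝ^ d) n) (c : Vector ℝ n) (i : Fin n) (t s : ℝ)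
  ([1-t]s≈1 : (1ℝ - t) * s ≈ 1ℝ) where

  open SetoidReasoning R.setoid

  private
    e c′ : Vector ℝ n
    e k  = fromℤ (δ i k)
    c′ k = s * (c k - t * e k)

    a : ℝ^ d
    a j = ∑ λ k → c′ k * v k j

    te≤c : (∀ k → 0ℝ ≤ c k) → t ≤ c i → ∀ k → t * e k ≤ c k
    te≤c 0≤c t≤cᵢ k with i Fin.≟ k
    ... | yes refl = ≤-trans
      (proj₁ (≈-trans (*-cong {t} ≈-refl (fromℤ-cong (δ-diagonal i))) (R.*-identityʳ t))) t≤cᵢ
    ... | no i≢k = ≤-trans
      (proj₁ (≈-trans (*-cong {t} ≈-refl (fromℤ-cong (δ-off-diagonal i≢k))) (R.zeroʳ t))) (0≤c k)

    [1-t]c′+te≈c : ∀ k → (1ℝ - t) * c′ k + t * e k ≈ c k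
    [1-t]c′+te≈c k = begin
      (1ℝ - t) * (s * (c k - t * e k)) + t * e k  ≈⟨ R.+-congʳ (R.*-assoc (1ℝ - t) s (c k - t * e k)) ⟨
      (1ℝ - t) * s * (c k - t * e k) + t * e k    ≈⟨ R.+-congʳ (*-cong [1-t]s≈1 ≈-refl) ⟩
      1ℝ * (c k - t * e k) + t * e k              ≈⟨ ≈-pointwise (λ n → solve 2 (λ c u →
                                                       con 1ℚ :* (c :+ (:- u)) :+ u := c) refl
                                                       (seq (c k) n) (seq (t * e k) n)) ⟩
      c k                                         ∎

  split-off-vertex : (λ j → ∑ λ k → c k * v k j) ≋ ((1ℝ - t) • a) ⊕ (t • v i)
  split-off-vertex j = begin
    (∑ λ k → c k * v k j)
      ≈⟨ R.sum-cong-≋ (λ k → *-cong ([1-t]c′+te≈c k) ≈-refl) ⟨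
    (∑ λ k → ((1ℝ - t) * c′ k + t * e k) * v k j)
      ≈⟨ R.sum-cong-≋ (λ k → ≈-pointwise λ n → solve 5 (λ r c t e v →
           (r :* c :+ t :* e) :* v := r :* (c :* v) :+ t :* (e :* v)) refl
           (seq (1ℝ - t) n) (seq (c′ k) n) (seq t n) (seq (e k) n) (seq (v k j) n)) ⟩
    (∑ λ k → (1ℝ - t) * (c′ k * v k j) + t * (e k * v k j))
      ≈⟨ R.∑-distrib-+ (λ k → (1ℝ - t) * (c′ k * v k j)) (λ k → t * (e k * v k j)) ⟩
    (∑ λ k → (1ℝ - t) * (c′ k * v k j)) + (∑ λ k → t * (e k * v k j))
      ≈⟨ R.+-cong (R.*-distribˡ-sum (1ℝ - t) (λ k → c′ k * v k j)) (R.*-distribˡ-sum t (λ k → e k * v k j)) ⟨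
    (1ℝ - t) * a j + t * (∑ λ k → e k * v k j)
      ≈⟨ R.+-congˡ {(1ℝ - t) * a j} (*-cong {t} ≈-refl (∑-δˡ (λ k → v k j) i)) ⟩
    (1ℝ - t) * a j + t * v i j ∎

  rest∈conv : (∀ k → 0ℝ ≤ c k) → ∑ c ≈ 1ℝ → 0ℝ ≤ s → t ≤ c i → conv v a
  rest∈conv 0≤c ∑c≈1 0≤s t≤cᵢ = c′
    , (λ k → *-nonNeg 0≤s (x≤y⇒0≤y-x (te≤c 0≤c t≤cᵢ k)))
    , (begin
        ∑ c′                                ≈⟨ R.*-distribˡ-sum s (λ k → c k - t * e k) ⟨
        s * (∑ λ k → c k - t * e k)         ≈⟨ *-cong {s} ≈-refl ∑[c-te]≈1-t ⟩
        s * (1ℝ - t)                        ≈⟨ R.*-comm s (1ℝ - t) ⟩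
        (1ℝ - t) * s                        ≈⟨ [1-t]s≈1 ⟩
        1ℝ                                  ∎)
    , λ _ → ≈-refl
    where
    ∑[c-te]≈1-t : (∑ λ k → c k - t * e k) ≈ 1ℝ - t
    ∑[c-te]≈1-t = begin
      (∑ λ k → c k - t * e k)             ≈⟨ R.sum-cong-≋ (λ k → R.+-congˡ {c k} (R.-‿distribˡ-* t (e k))) ⟩
      (∑ λ k → c k + -ℝ t * e k)          ≈⟨ R.∑-distrib-+ c (λ k → -ℝ t * e k) ⟩
      ∑ c + (∑ λ k → -ℝ t * e k)          ≈⟨ R.+-cong ∑c≈1 (≈-sym (R.*-distribˡ-sum (-ℝ t) e)) ⟩
      1ℝ + -ℝ t * ∑ e                     ≈⟨ R.+-congˡ {1ℝ} (*-cong { -ℝ t} ≈-refl (∑δ≈1 i)) ⟩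
      1ℝ + -ℝ t * 1ℝ                      ≈⟨ R.+-congˡ {1ℝ} (R.*-identityʳ (-ℝ t)) ⟩
      1ℝ - t                              ∎

-- Some weight in a convex combination for x is positive. A rational q in (0, 1) below it gives x =
-- (1 - q) a + q vᵢ with a in the hull; extremality forces a = vᵢ, hence x = vᵢ. Since q < 1, the
-- number 1 - q has the reciprocal r used for rescaling.
extreme⇒vertex : ∀ {d n} (v : Vector (ℝ^ d) n) x → IsVertex (conv v) x → ∃ λ i → x ≋ v i
extreme⇒vertex v x ((c , 0≤c , ∑c≈1 , x≋) , extreme) =
  let i , 0<cᵢ = 0<∑⇒∃0< c (<-≈-trans 0<1ℝ (≈-sym ∑c≈1))
      q , 0<q , q<1 , q≤cᵢ = positive-rational-below 0<cᵢ
      0<1-q = p<q⇒0<q-p q<1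
      r , 0<r , eq = quotient (1ℚ ℚ.- q) 1ℚ 0<1-q (ℚ.positive⁻¹ 1ℚ)
  in i , at-vertex i q r 0<q 0<1-q 0<r (≈-pointwise λ _ → eq) q≤cᵢ
  where
  at-vertex : ∀ i q r → 0ℚ ℚ.< q → 0ℚ ℚ.< 1ℚ ℚ.- q → 0ℚ ℚ.< r →
    (1ℝ - fromℚ q) * fromℚ r ≈ 1ℝ → fromℚ q ≤ c i → x ≋ v i
  at-vertex i q r 0<q 0<1-q 0<r inverse q≤cᵢ j = begin
    x j                                        ≈⟨ decomposition j ⟩
    (1ℝ - fromℚ q) * a j + fromℚ q * v i j     ≈⟨ R.+-congʳ (*-cong {1ℝ - fromℚ q} ≈-refl (a≋vᵢ j)) ⟩
    (1ℝ - fromℚ q) * v i j + fromℚ q * v i j   ≈⟨ ≈-pointwise (λ n → solve 2 (λ t v →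
                                                    (con 1ℚ :+ (:- t)) :* v :+ t :* v := v) refl
                                                    q (seq (v i j) n)) ⟩
    v i j                                      ∎
    where
    open SetoidReasoning R.setoid
    a : ℝ^ _
    a j = ∑ λ k → fromℚ r * (c k - fromℚ q * fromℤ (δ i k)) * v k j

    decomposition : x ≋ ((1ℝ - fromℚ q) • a) ⊕ (fromℚ q • v i)
    decomposition j = ≈-trans (x≋ j) (split-off-vertex v c i (fromℚ q) (fromℚ r) inverse j)

    a≋vᵢ : a ≋ v i
    a≋vᵢ = extreme a (v i) (fromℚ q)
      (rest∈conv v c i (fromℚ q) (fromℚ r) inverse 0≤c ∑c≈1 (fromℚ-mono-≤ (ℚ.<⇒≤ 0<r)) q≤cᵢ)
      (vertex∈conv v i)
      (mk< q 0<q (0 , λ _ _ → ℚ.≤-reflexive (ℚ.+-identityˡ q)))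
      (mk< (1ℚ ℚ.- q) 0<1-q (0 , λ _ _ → ℚ.≤-reflexive
        (solve 1 (λ q → q :+ (con 1ℚ :+ (:- q)) := con 1ℚ) refl q)))
      decomposition

conv-isLatticePolytope : ∀ {d n} (v : Vector (ℤ^ d) n) → IsLatticePolytope (conv λ i → ι (v i))
conv-isLatticePolytope {n = n} v = (n , (λ i → ι (v i)) , id , id) , λ x vertex →
  let i , x≋vᵢ = extreme⇒vertex _ x vertex in v i , x≋vᵢ

-- Integral functionals

∙-congˡ : ∀ {d} {h k : ℤ^ d} → h ≗ k → ∀ v → h ∙ v ≡ k ∙ v
∙-congˡ h≗k v = ℤR.sum-cong-≋ λ j → cong (ℤ._* v j) (h≗k j)

∙-+ˡ : ∀ {d} (h k v : ℤ^ d) → (h +ᶻ k) ∙ v ≡ h ∙ v ℤ.+ k ∙ v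
∙-+ˡ h k v = trans (ℤR.sum-cong-≋ λ j → ℤ.*-distribʳ-+ (v j) (h j) (k j))
  (ℤR.∑-distrib-+ (λ j → h j ℤ.* v j) (λ j → k j ℤ.* v j))

∙-•ˡ : ∀ {d} m (h v : ℤ^ d) → (m •ᶻ h) ∙ v ≡ m ℤ.* (h ∙ v)
∙-•ˡ m h v = trans (ℤR.sum-cong-≋ λ j → ℤ.*-assoc m (h j) (v j))
  (sym (ℤR.*-distribˡ-sum m (λ j → h j ℤ.* v j)))

∙-∑ˡ : ∀ {d n} (c : Vector ℤ n) (b : Vector (ℤ^ d) n) v →
  (λ j → ∑ᶻ λ i → c i ℤ.* b i j) ∙ v ≡ ∑ᶻ λ i → c i ℤ.* (b i ∙ v)
∙-∑ˡ c b v = begin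
  (∑ᶻ λ j → (∑ᶻ λ i → c i ℤ.* b i j) ℤ.* v j)
    ≡⟨ ℤR.sum-cong-≋ (λ j → ℤR.*-distribʳ-sum (v j) (λ i → c i ℤ.* b i j)) ⟩
  (∑ᶻ λ j → ∑ᶻ λ i → c i ℤ.* b i j ℤ.* v j)
    ≡⟨ ℤR.∑-comm (λ j i → c i ℤ.* b i j ℤ.* v j) ⟩
  (∑ᶻ λ i → ∑ᶻ λ j → c i ℤ.* b i j ℤ.* v j)
    ≡⟨ ℤR.sum-cong-≋ (λ i → ∙-•ˡ (c i) (b i) v) ⟩
  (∑ᶻ λ i → c i ℤ.* (b i ∙ v)) ∎
  where open ≡-Reasoning

∑ᶻ-nonNeg : ∀ {n} (f : Vector ℤ n) → (∀ i → + 0 ℤ.≤ f i) → + 0 ℤ.≤ ∑ᶻ f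
∑ᶻ-nonNeg {zero}  f 0≤f = ℤ.≤-refl
∑ᶻ-nonNeg {suc n} f 0≤f = ℤ.+-mono-≤ (0≤f zero) (∑ᶻ-nonNeg (f ∘ suc) (0≤f ∘ suc))

f≤∑ᶻ : ∀ {n} (f : Vector ℤ n) → (∀ i → + 0 ℤ.≤ f i) → ∀ i → f i ℤ.≤ ∑ᶻ f
f≤∑ᶻ {suc n} f 0≤f i = begin
  f i                                   ≡⟨ ℤ.+-identityʳ (f i) ⟨
  f i ℤ.+ + 0                           ≤⟨ ℤ.+-monoʳ-≤ (f i) (∑ᶻ-nonNeg (f ∘ punchIn i) (0≤f ∘ punchIn i)) ⟩
  f i ℤ.+ ∑ᶻ (f ∘ punchIn i)            ≡⟨ ℤR.sum-remove f ⟨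
  ∑ᶻ f                                  ∎
  where open ℤ.≤-Reasoning

fᵢ+fⱼ≤∑ᶻ : ∀ {n} (f : Vector ℤ n) → (∀ i → + 0 ℤ.≤ f i) →
  ∀ {i j} → i ≢ j → f i ℤ.+ f j ℤ.≤ ∑ᶻ f
fᵢ+fⱼ≤∑ᶻ {suc n} f 0≤f {i} {j} i≢j = begin
  f i ℤ.+ f j                           ≡⟨ cong (λ k → f i ℤ.+ f k) (Fin.punchIn-punchOut i≢j) ⟨
  f i ℤ.+ f (punchIn i (punchOut i≢j))
    ≤⟨ ℤ.+-monoʳ-≤ (f i) (f≤∑ᶻ (f ∘ punchIn i) (0≤f ∘ punchIn i) (punchOut i≢j)) ⟩
  f i ℤ.+ ∑ᶻ (f ∘ punchIn i)            ≡⟨ ℤR.sum-remove f ⟨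
  ∑ᶻ f                                  ∎
  where open ℤ.≤-Reasoning

-- Coordinates modulo 2

odd : ℕ → ℤ
odd q = + suc (q ℕ.+ q)

even-or-odd : ∀ c → + 2 Signed.∣ c ⊎ ∃ λ q → c ≡ odd q ⊎ c ≡ ℤ.- odd q
even-or-odd c = by-abs c (halve ℤ.∣ c ∣)
  where
  halve : ∀ n → ∃ λ q → n ≡ q ℕ.+ q ⊎ n ≡ suc (q ℕ.+ q)
  halve zero = 0 , inj₁ refl
  halve (suc n) with halve n
  ... | q , inj₁ eq = q , inj₂ (cong suc eq)
  ... | q , inj₂ eq = suc q , inj₁ (cong suc (trans eq (sym (ℕ.+-suc q q))))

  q+q≡q*2 : ∀ q → q ℕ.+ q ≡ q ℕ.* 2
  q+q≡q*2 q = trans (cong (q ℕ.+_) (sym (ℕ.+-identityʳ q))) (ℕ.*-comm 2 q)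

  by-abs : ∀ c → (∃ λ q → ℤ.∣ c ∣ ≡ q ℕ.+ q ⊎ ℤ.∣ c ∣ ≡ suc (q ℕ.+ q)) →
    + 2 Signed.∣ c ⊎ ∃ λ q → c ≡ odd q ⊎ c ≡ ℤ.- odd q
  by-abs c        (q , inj₁ eq) = inj₁ (Signed.∣-trans
    (Signed.divides (+ q) (trans (cong +_ (trans eq (q+q≡q*2 q))) (ℤ.pos-* q 2))) Signed.∣m∣∣m)
  by-abs (+ n)    (q , inj₂ eq) = inj₂ (q , inj₁ (cong +_ eq))
  by-abs -[1+ n ] (q , inj₂ eq) = inj₂ (q , inj₂ (cong (ℤ.-_ ∘ +_) eq))

∣-∑ᶻ : ∀ {k n} (f : Vector ℤ n) → (∀ i → k Signed.∣ f i) → k Signed.∣ ∑ᶻ f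
∣-∑ᶻ {k} {zero}  f k∣f = Signed.divides (+ 0) refl
∣-∑ᶻ {k} {suc n} f k∣f = Signed.∣m∣n⇒∣m+n (k∣f zero) (∣-∑ᶻ (f ∘ suc) (k∣f ∘ suc))

-- Coordinates in a lattice basis

module Basis {d} {b : Vector (ℤ^ d) d} (basis : IsBasis b) where

  coordinates : ℤ^ d → ℤ^ d
  coordinates v = proj₁ (basis v)

  coordinates-∑ : ∀ v j → (∑ᶻ λ i → coordinates v i ℤ.* b i j) ≡ v j
  coordinates-∑ v = proj₁ (proj₂ (basis v))

  coordinates-unique : ∀ {v} c → (∀ j → (∑ᶻ λ i → c i ℤ.* b i j) ≡ v j) → ∀ i → coordinates v i ≡ c i
  coordinates-unique {v} c = proj₂ (proj₂ (basis v)) {c}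

  -- The i-th coordinate of `b i` is 1, and `b i` is the combination of the unit vectors with
  -- coefficients `b i j`. Linearity of the coordinates comes from their uniqueness: the combined
  -- coordinates also represent `b i`.
  ∑-coordinates-δ : ∀ i → (∑ᶻ λ j → b i j ℤ.* coordinates (δ j) i) ≡ + 1
  ∑-coordinates-δ i = begin
    (∑ᶻ λ j → b i j ℤ.* coordinates (δ j) i)  ≡⟨ coordinates-unique (λ l → ∑ᶻ λ j → b i j ℤ.* coordinates (δ j) l) expand i ⟨
    coordinates (b i) i                       ≡⟨ coordinates-unique (δ i) (λ k → ∑ᶻ-δˡ (λ l → b l k) i) i ⟩
    δ i i                                     ≡⟨ δ-diagonal i ⟩
    + 1                                       ∎
    where
    open ≡-Reasoning
    expand : ∀ k → (∑ᶻ λ l → (∑ᶻ λ j → b i j ℤ.* coordinates (δ j) l) ℤ.* b l k) ≡ b i k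
    expand k = begin
      (∑ᶻ λ l → (∑ᶻ λ j → b i j ℤ.* coordinates (δ j) l) ℤ.* b l k)
        ≡⟨ ∙-∑ˡ (b i) (λ j → coordinates (δ j)) (λ l → b l k) ⟩
      (∑ᶻ λ j → b i j ℤ.* (∑ᶻ λ l → coordinates (δ j) l ℤ.* b l k))
        ≡⟨ ℤR.sum-cong-≋ (λ j → cong (b i j ℤ.*_) (coordinates-∑ (δ j) k)) ⟩
      (∑ᶻ λ j → b i j ℤ.* δ j k)
        ≡⟨ ℤR.sum-cong-≋ (λ j → trans (ℤ.*-comm (b i j) (δ j k)) (cong (ℤ._* b i j) (δ-sym j k))) ⟩
      (∑ᶻ λ j → δ k j ℤ.* b i j)
        ≡⟨ ∑ᶻ-δˡ (b i) k ⟩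
      b i k ∎
      where
      δ-sym : ∀ {d} (j k : Fin d) → δ j k ≡ δ k j
      δ-sym zero    zero    = refl
      δ-sym zero    (suc k) = refl
      δ-sym (suc j) zero    = refl
      δ-sym (suc j) (suc k) = δ-sym j k

  -- If all the numbers `coordinates (δ j) i` were even, the combination of them that equals 1 would
  -- be even.
  odd-coordinate : ∀ i → ∃ λ j → ¬ + 2 Signed.∣ coordinates (δ j) i
  odd-coordinate i = Fin.¬∀⟶∃¬ d _ (λ j → + 2 Signed.∣? coordinates (δ j) i) λ 2∣ →
    2∤1 (subst (+ 2 Signed.∣_) (∑-coordinates-δ i) (∣-∑ᶻ _ λ j → Signed.∣n⇒∣m*n (b i j) (2∣ j)))
    where
    2∤1 : ¬ + 2 Signed.∣ + 1
    2∤1 = from-yes (¬? (+ 2 Signed.∣? + 1))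

  -- If column j of the basis vanished, every integral combination would have j-th entry 0, whereas
  -- `δ j` has 1 there.
  nonzero-entry : ∀ j → ∃ λ i → b i j ≢ + 0
  nonzero-entry j = Fin.¬∀⟶∃¬ d _ (λ i → b i j ℤ.≟ + 0) λ b≡0 →
    contradiction
      (trans (sym (trans (coordinates-∑ (δ j) j) (δ-diagonal j)))
        (trans (ℤR.sum-cong-≋ λ i → trans (cong (coordinates (δ j) i ℤ.*_) (b≡0 i)) (ℤ.*-zeroʳ (coordinates (δ j) i)))
          (ℤR.sum-replicate-zero d)))
      λ ()

-- Euclidean division of a + q by 2q + 1 leaves a remainder in [0, 2q]; shifting back by q centres
-- it. The odd modulus makes the interval symmetric.
balanced-division : ∀ a q → ∃ λ m → ∃ λ r →
  a ≡ r ℤ.+ m ℤ.* odd q × ℤ.- + q ℤ.≤ r × r ℤ.≤ + q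
balanced-division a q = m , r , a≡r+mn , -q≤r , r≤q
  where
  n = suc (q ℕ.+ q)
  m = (a ℤ.+ + q) /ℕ n
  r′ = (a ℤ.+ + q) %ℕ n
  r = + r′ ℤ.- + q

  shift : ∀ a q → a ≡ a ℤ.+ q ℤ.- q
  shift = solve-∀

  rearrange : ∀ r q c → r ℤ.+ c ℤ.- q ≡ r ℤ.- q ℤ.+ c
  rearrange = solve-∀

  a≡r+mn : a ≡ r ℤ.+ m ℤ.* odd q
  a≡r+mn = trans (shift a (+ q))
    (trans (cong (ℤ._- + q) (a≡a%ℕn+[a/ℕn]*n (a ℤ.+ + q) n)) (rearrange (+ r′) (+ q) (m ℤ.* + n)))

  -q≤r : ℤ.- + q ℤ.≤ r
  -q≤r = ℤ.≤-trans (ℤ.≤-reflexive (sym (ℤ.+-identityˡ (ℤ.- + q)))) (ℤ.+-monoˡ-≤ (ℤ.- + q) (ℤ.+≤+ ℕ.z≤n))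

  r≤q : r ℤ.≤ + q
  r≤q = ℤ.≤-trans (ℤ.+-monoˡ-≤ (ℤ.- + q) (ℤ.+≤+ (ℕ.≤-pred (n%ℕd<d (a ℤ.+ + q) n))))
    (ℤ.≤-reflexive (sym (shift (+ q) (+ q))))

-- A case distinction on signs is avoided by the identity (r + q)(s + w) + (q - r)(w - s) = 2qw +
-- 2rs, whose left side is a sum of products of nonnegative numbers.
-rs≤qw : ∀ {r s q w} → ℤ.- q ℤ.≤ r → r ℤ.≤ q → ℤ.- w ℤ.≤ s → s ℤ.≤ w → ℤ.- (r ℤ.* s) ℤ.≤ q ℤ.* w
-rs≤qw {r} {s} {q} {w} -q≤r r≤q -w≤s s≤w = ℤ.*-cancelˡ-≤-pos _ _ (+ 2) (ℤ.0≤i-j⇒j≤i (begin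
  + 0
    ≤⟨ ℤ.+-mono-≤ (nonNeg (0≤q+r -q≤r) (0≤q+r -w≤s)) (nonNeg (ℤ.i≤j⇒0≤j-i r≤q) (ℤ.i≤j⇒0≤j-i s≤w)) ⟩
  (r ℤ.- ℤ.- q) ℤ.* (s ℤ.- ℤ.- w) ℤ.+ (q ℤ.- r) ℤ.* (w ℤ.- s)
    ≡⟨ identity q r w s ⟩
  + 2 ℤ.* (q ℤ.* w) ℤ.- + 2 ℤ.* ℤ.- (r ℤ.* s) ∎))
  where
  open ℤ.≤-Reasoning
  0≤q+r : ∀ {q r} → ℤ.- q ℤ.≤ r → + 0 ℤ.≤ r ℤ.- ℤ.- q
  0≤q+r = ℤ.i≤j⇒0≤j-i
  nonNeg : ∀ {i j} → + 0 ℤ.≤ i → + 0 ℤ.≤ j → + 0 ℤ.≤ i ℤ.* j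
  nonNeg {i} 0≤i 0≤j = ℤ.≤-trans (ℤ.≤-reflexive (sym (ℤ.*-zeroʳ i)))
    (ℤ.*-monoˡ-≤-nonNeg i {{ℤ.nonNegative 0≤i}} 0≤j)
  identity : ∀ q r w s →
    (r ℤ.- ℤ.- q) ℤ.* (s ℤ.- ℤ.- w) ℤ.+ (q ℤ.- r) ℤ.* (w ℤ.- s)
      ≡ + 2 ℤ.* (q ℤ.* w) ℤ.- + 2 ℤ.* ℤ.- (r ℤ.* s)
  identity = solve-∀

-- Widths of finite sets of lattice points

argmax : ∀ {n} (f : Vector ℤ (suc n)) → ∃ λ i → ∀ j → f j ℤ.≤ f i
argmax {zero}  f = zero , λ { zero → ℤ.≤-refl }
argmax {suc n} f with argmax (f ∘ suc)
... | i , f≤fᵢ with ℤ.≤-total (f zero) (f (suc i))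
...   | inj₁ f₀≤fᵢ = suc i , λ { zero → f₀≤fᵢ ; (suc j) → f≤fᵢ j }
...   | inj₂ fᵢ≤f₀ = zero , λ { zero → ℤ.≤-refl ; (suc j) → ℤ.≤-trans (f≤fᵢ j) fᵢ≤f₀ }

module Width {d n} (p : Vector (ℤ^ d) (suc n)) where

  top bottom : ℤ^ d → Fin (suc n)
  top    h = proj₁ (argmax λ i → h ∙ p i)
  bottom h = proj₁ (argmax λ i → ℤ.- (h ∙ p i))

  ≤top : ∀ h i → h ∙ p i ℤ.≤ h ∙ p (top h)
  ≤top h = proj₂ (argmax λ i → h ∙ p i)

  bottom≤ : ∀ h i → h ∙ p (bottom h) ℤ.≤ h ∙ p i
  bottom≤ h i = ℤ.neg-cancel-≤ (proj₂ (argmax λ i → ℤ.- (h ∙ p i)) i)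

  width : ℤ^ d → ℤ
  width h = h ∙ p (top h) ℤ.- h ∙ p (bottom h)

  difference≤width : ∀ h i j → h ∙ p i ℤ.- h ∙ p j ℤ.≤ width h
  difference≤width h i j = ℤ.+-mono-≤ (≤top h i) (ℤ.neg-mono-≤ (bottom≤ h j))

  -width≤difference : ∀ h i j → ℤ.- width h ℤ.≤ h ∙ p i ℤ.- h ∙ p j
  -width≤difference h i j = ℤ.≤-trans (ℤ.neg-mono-≤ (difference≤width h j i))
    (ℤ.≤-reflexive (flip (h ∙ p i) (h ∙ p j)))
    where
    flip : ∀ a b → ℤ.- (b ℤ.- a) ≡ a ℤ.- b
    flip = solve-∀

  module _ (h₁ h₂ h₃ : ℤ^ d) (w₁≤w₃ : width h₁ ℤ.≤ width h₃) (w₂≤w₃ : width h₂ ℤ.≤ width h₃)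
    (w₃≤ : ∀ m k → width h₃ ℤ.≤ width (m •ᶻ h₁ +ᶻ k •ᶻ h₂ +ᶻ h₃)) where

    -- Reduce the coefficients of h₁ and h₂ modulo the odd coefficient
    -- 2q + 1 of h₃ to remainders in [-q, q] and use the triangle inequality.
    positive-odd-coefficient : ∀ q a b (X : Vector ℤ (suc n)) {K} → (∀ i j → X i ℤ.- X j ℤ.≤ K) →
      (∀ i → X i ≡ a ℤ.* (h₁ ∙ p i) ℤ.+ (b ℤ.* (h₂ ∙ p i) ℤ.+ odd q ℤ.* (h₃ ∙ p i))) →
      width h₃ ℤ.≤ K
    positive-odd-coefficient q a b X {K} X≤K X≡ = ℤ.0≤i-j⇒j≤i (begin
      + 0
        ≤⟨ ℤ.i≤j⇒0≤j-i nw₃≤ ⟩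
      K ℤ.+ (+ q ℤ.* w ℤ.+ + q ℤ.* w) ℤ.- odd q ℤ.* w
        ≡⟨ cancel K (+ q) w ⟩
      K ℤ.- w ∎)
      where
      open ℤ.≤-Reasoning
      w = width h₃
      division-a = balanced-division a q
      division-b = balanced-division b q
      m = proj₁ division-a
      k = proj₁ division-b
      r = proj₁ (proj₂ division-a)
      s = proj₁ (proj₂ division-b)
      -- On differences of points, (2q+1) h is the functional with values `X` minus r h₁ + s h₂.
      -- Evaluating at the points where h attains its width bounds ‖h‖, and ‖h₃‖ ≤ ‖h‖ by
      -- reducedness.
      h = m •ᶻ h₁ +ᶻ k •ᶻ h₂ +ᶻ h₃
      i = top h
      j = bottom h

      expand : ∀ i → h ∙ p i ≡ m ℤ.* (h₁ ∙ p i) ℤ.+ k ℤ.* (h₂ ∙ p i) ℤ.+ h₃ ∙ p i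
      expand i = trans (∙-+ˡ (m •ᶻ h₁ +ᶻ k •ᶻ h₂) h₃ (p i)) (cong (ℤ._+ h₃ ∙ p i)
        (trans (∙-+ˡ (m •ᶻ h₁) (k •ᶻ h₂) (p i)) (cong₂ ℤ._+_ (∙-•ˡ m h₁ (p i)) (∙-•ˡ k h₂ (p i)))))

      regroup : ∀ n m k r s A B C A′ B′ C′ →
        n ℤ.* (m ℤ.* A ℤ.+ k ℤ.* B ℤ.+ C ℤ.- (m ℤ.* A′ ℤ.+ k ℤ.* B′ ℤ.+ C′))
          ≡ ((r ℤ.+ m ℤ.* n) ℤ.* A ℤ.+ ((s ℤ.+ k ℤ.* n) ℤ.* B ℤ.+ n ℤ.* C)
              ℤ.- ((r ℤ.+ m ℤ.* n) ℤ.* A′ ℤ.+ ((s ℤ.+ k ℤ.* n) ℤ.* B′ ℤ.+ n ℤ.* C′)))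
            ℤ.+ (ℤ.- (r ℤ.* (A ℤ.- A′)) ℤ.+ ℤ.- (s ℤ.* (B ℤ.- B′)))
      regroup = solve-∀

      X≡′ : ∀ i → (r ℤ.+ m ℤ.* odd q) ℤ.* (h₁ ∙ p i)
        ℤ.+ ((s ℤ.+ k ℤ.* odd q) ℤ.* (h₂ ∙ p i) ℤ.+ odd q ℤ.* (h₃ ∙ p i)) ≡ X i
      X≡′ i = trans
        (cong₂ (λ a b → a ℤ.* (h₁ ∙ p i) ℤ.+ (b ℤ.* (h₂ ∙ p i) ℤ.+ odd q ℤ.* (h₃ ∙ p i)))
          (sym (proj₁ (proj₂ (proj₂ division-a)))) (sym (proj₁ (proj₂ (proj₂ division-b)))))
        (sym (X≡ i))

      remainder≤ : ∀ h {r} → width h ℤ.≤ w → ℤ.- + q ℤ.≤ r × r ℤ.≤ + q →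
        ℤ.- (r ℤ.* (h ∙ p i ℤ.- h ∙ p j)) ℤ.≤ + q ℤ.* w
      remainder≤ h w′≤w (-q≤r , r≤q) = ℤ.≤-trans
        (-rs≤qw -q≤r r≤q (-width≤difference h i j) (difference≤width h i j))
        (ℤ.*-monoˡ-≤-nonNeg (+ q) w′≤w)

      nw₃≤ : odd q ℤ.* w ℤ.≤ K ℤ.+ (+ q ℤ.* w ℤ.+ + q ℤ.* w)
      nw₃≤ = begin
        odd q ℤ.* w
          ≤⟨ ℤ.*-monoˡ-≤-nonNeg (odd q) (w₃≤ m k) ⟩
        odd q ℤ.* (h ∙ p i ℤ.- h ∙ p j)
          ≡⟨ cong (odd q ℤ.*_) (cong₂ ℤ._-_ (expand i) (expand j)) ⟩
        odd q ℤ.* _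
          ≡⟨ regroup (odd q) m k r s (h₁ ∙ p i) (h₂ ∙ p i) (h₃ ∙ p i) (h₁ ∙ p j) (h₂ ∙ p j) (h₃ ∙ p j) ⟩
        _
          ≡⟨ cong (ℤ._+ (ℤ.- (r ℤ.* (h₁ ∙ p i ℤ.- h₁ ∙ p j)) ℤ.+ ℤ.- (s ℤ.* (h₂ ∙ p i ℤ.- h₂ ∙ p j))))
               (cong₂ ℤ._-_ (X≡′ i) (X≡′ j)) ⟩
        X i ℤ.- X j ℤ.+ (ℤ.- (r ℤ.* (h₁ ∙ p i ℤ.- h₁ ∙ p j)) ℤ.+ ℤ.- (s ℤ.* (h₂ ∙ p i ℤ.- h₂ ∙ p j)))
          ≤⟨ ℤ.+-mono-≤ (X≤K i j) (ℤ.+-mono-≤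
               (remainder≤ h₁ w₁≤w₃ (proj₂ (proj₂ (proj₂ division-a))))
               (remainder≤ h₂ w₂≤w₃ (proj₂ (proj₂ (proj₂ division-b))))) ⟩
        K ℤ.+ (+ q ℤ.* w ℤ.+ + q ℤ.* w) ∎

      cancel : ∀ K q w → K ℤ.+ (q ℤ.* w ℤ.+ q ℤ.* w) ℤ.- (+ 1 ℤ.+ (q ℤ.+ q)) ℤ.* w ≡ K ℤ.- w
      cancel = solve-∀

    -- A negative odd coefficient becomes positive on replacing `X` by its negative, whose
    -- differences obey the same bound. The trailing `+ 0` is what a sum over three coordinates
    -- unfolds to.
    odd-coefficient : ∀ a b c → ¬ + 2 Signed.∣ c → (X : Vector ℤ (suc n)) → ∀ {K} → (∀ i j → X i ℤ.- X j ℤ.≤ K) →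
      (∀ i → X i ≡ a ℤ.* (h₁ ∙ p i) ℤ.+ (b ℤ.* (h₂ ∙ p i) ℤ.+ (c ℤ.* (h₃ ∙ p i) ℤ.+ + 0))) →
      width h₃ ℤ.≤ K
    odd-coefficient a b c 2∤c X X≤K X≡ with even-or-odd c
    ... | inj₁ 2∣c = contradiction 2∣c 2∤c
    ... | inj₂ (q , inj₁ refl) = positive-odd-coefficient q a b X X≤K
      λ i → trans (X≡ i) (drop-0 a b (odd q) (h₁ ∙ p i) (h₂ ∙ p i) (h₃ ∙ p i))
      where
      drop-0 : ∀ a b c A B C → a ℤ.* A ℤ.+ (b ℤ.* B ℤ.+ (c ℤ.* C ℤ.+ + 0)) ≡ a ℤ.* A ℤ.+ (b ℤ.* B ℤ.+ c ℤ.* C)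
      drop-0 = solve-∀
    ... | inj₂ (q , inj₂ refl) = positive-odd-coefficient q (ℤ.- a) (ℤ.- b) (λ i → ℤ.- X i)
      (λ i j → ℤ.≤-trans (ℤ.≤-reflexive (flip (X i) (X j))) (X≤K j i))
      λ i → trans (cong ℤ.-_ (X≡ i)) (negate a b (odd q) (h₁ ∙ p i) (h₂ ∙ p i) (h₃ ∙ p i))
      where
      flip : ∀ a b → ℤ.- a ℤ.- ℤ.- b ≡ b ℤ.- a
      flip = solve-∀
      negate : ∀ a b n A B C → ℤ.- (a ℤ.* A ℤ.+ (b ℤ.* B ℤ.+ (ℤ.- n ℤ.* C ℤ.+ + 0)))
        ≡ ℤ.- a ℤ.* A ℤ.+ (ℤ.- b ℤ.* B ℤ.+ n ℤ.* C)
      negate = solve-∀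

-- The short functionals

-- The bound 11 is the largest norm of a unit vector: e₁, e₂, e₃ have norms 1, 10, 11.
Short : ℤ^ 3 → Set
Short h = ∀ i j → h ∙ points i ℤ.- h ∙ points j ℤ.≤ + 11

short? : ∀ h → Dec (Short h)
short? h = Fin.all? λ i → Fin.all? λ j → h ∙ points i ℤ.- h ∙ points j ℤ.≤? + 11

Short-± : ∀ {h σ} → σ ≡ + 1 ⊎ σ ≡ ℤ.- + 1 → Short h → Short (σ •ᶻ h)
Short-± {h} {σ} ±1 short i j = subst₂ (λ a b → a ℤ.- b ℤ.≤ + 11)
  (sym (∙-•ˡ σ h (points i))) (sym (∙-•ˡ σ h (points j))) (bound ±1)
  where
  positive : ∀ a b → + 1 ℤ.* a ℤ.- + 1 ℤ.* b ≡ a ℤ.- b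
  positive = solve-∀
  negative : ∀ a b → ℤ.- + 1 ℤ.* a ℤ.- ℤ.- + 1 ℤ.* b ≡ b ℤ.- a
  negative = solve-∀
  bound : σ ≡ + 1 ⊎ σ ≡ ℤ.- + 1 → σ ℤ.* (h ∙ points i) ℤ.- σ ℤ.* (h ∙ points j) ℤ.≤ + 11
  bound (inj₁ refl) = ℤ.≤-trans (ℤ.≤-reflexive (positive (h ∙ points i) (h ∙ points j))) (short i j)
  bound (inj₂ refl) = ℤ.≤-trans (ℤ.≤-reflexive (negative (h ∙ points i) (h ∙ points j))) (short j i)

Triple : Set
Triple = ℤ × ℤ × ℤ

vector : Triple → ℤ^ 3
vector (x , y , z) = x ∷ y ∷ z ∷ []

triple : ℤ^ 3 → Triple
triple h = h zero , h (suc zero) , h (suc (suc zero))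

interval : ℕ → List ℤ
interval n = List.map (λ k → + k ℤ.- + n) (upTo (suc (n ℕ.+ n)))

∈-interval : ∀ {n z} → ℤ.- + n ℤ.≤ z → z ℤ.≤ + n → z ∈ interval n
∈-interval {n} {z} -n≤z z≤n = subst (_∈ interval n) k-n≡z
  (∈-map⁺ (λ k → + k ℤ.- + n) (∈-upTo⁺ (ℕ.s≤s (ℤ.drop‿+≤+ k≤2n))))
  where
  cancel : ∀ z n → z ℤ.+ n ℤ.- n ≡ z
  cancel = solve-∀
  k = ℤ.∣ z ℤ.+ + n ∣
  k≡z+n : + k ≡ z ℤ.+ + n
  k≡z+n = ℤ.0≤i⇒+∣i∣≡i (ℤ.≤-trans (ℤ.≤-reflexive (sym (ℤ.+-inverseˡ (+ n)))) (ℤ.+-monoˡ-≤ (+ n) -n≤z))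
  k-n≡z : + k ℤ.- + n ≡ z
  k-n≡z = trans (cong (ℤ._- + n) k≡z+n) (cancel z (+ n))
  k≤2n : + k ℤ.≤ + (n ℕ.+ n)
  k≤2n = subst (ℤ._≤ + (n ℕ.+ n)) (sym k≡z+n) (ℤ.+-monoˡ-≤ (+ n) z≤n)

-- Multiples of the unit vectors are combinations of differences of the points: (2,0,0) = 2 (1,-6,0)
-- + 3 (0,4,0), (0,4,0) itself, and (0,0,44) = 4 (0,1,11) - (0,4,0). Hence 2x ≤ 55, 4y ≤ 11 and 44z
-- ≤ 55. Applied to -h as well, this confines h to a box.
short⇒≤ : ∀ h → Short h →
  h zero ℤ.≤ + 27 × h (suc zero) ℤ.≤ + 2 × h (suc (suc zero)) ℤ.≤ + 1
short⇒≤ h short =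
    divide 1 (x-identity x y z) (ℤ.+-mono-≤ (scale 2 (short p₃ p₁)) (scale 3 (short p₀ p₁))) (ℤ.+<+ ℕ.≤-refl)
  , divide 3 (y-identity x y z) (short p₀ p₁) (ℤ.+<+ ℕ.≤-refl)
  , divide 43 (z-identity x y z) (ℤ.+-mono-≤ (scale 4 (short p₀ p₂)) (short p₁ p₀)) (from-yes (+ 55 ℤ.<? + 88))
  where
  x = h zero
  y = h (suc zero)
  z = h (suc (suc zero))
  p₀ p₁ p₂ p₃ : Fin 6
  p₀ = zero
  p₁ = suc zero
  p₂ = suc (suc zero)
  p₃ = suc (suc (suc zero))

  scale : ∀ n {a b} → a ℤ.≤ b → + n ℤ.* a ℤ.≤ + n ℤ.* b
  scale n = ℤ.*-monoˡ-≤-nonNeg (+ n)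

  divide : ∀ k {n i a b} → + suc k ℤ.* i ≡ a → a ℤ.≤ b → b ℤ.< + suc k ℤ.* + suc n → i ℤ.≤ + n
  divide k {n} {i} refl a≤b b<n =
    ℤ.i<j⇒i≤pred[j] {j = + suc n} (ℤ.*-cancelˡ-<-nonNeg {i} {+ suc n} (+ suc k) (ℤ.≤-<-trans a≤b b<n))

  -- The right sides of the identities spell out the scalar products as they unfold, so that they
  -- match `h ∙ points i` by computation.
  x-identity : ∀ x y z → + 2 ℤ.* x ≡
    + 2 ℤ.* ((x ℤ.* + 1 ℤ.+ (y ℤ.* ℤ.- (+ 8) ℤ.+ (z ℤ.* + 5 ℤ.+ + 0)))
          ℤ.- (x ℤ.* + 0 ℤ.+ (y ℤ.* ℤ.- (+ 2) ℤ.+ (z ℤ.* + 5 ℤ.+ + 0))))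
      ℤ.+ + 3 ℤ.* ((x ℤ.* + 0 ℤ.+ (y ℤ.* + 2 ℤ.+ (z ℤ.* + 5 ℤ.+ + 0)))
                ℤ.- (x ℤ.* + 0 ℤ.+ (y ℤ.* ℤ.- (+ 2) ℤ.+ (z ℤ.* + 5 ℤ.+ + 0))))
  x-identity = solve-∀

  y-identity : ∀ x y z → + 4 ℤ.* y ≡
    (x ℤ.* + 0 ℤ.+ (y ℤ.* + 2 ℤ.+ (z ℤ.* + 5 ℤ.+ + 0)))
      ℤ.- (x ℤ.* + 0 ℤ.+ (y ℤ.* ℤ.- (+ 2) ℤ.+ (z ℤ.* + 5 ℤ.+ + 0)))
  y-identity = solve-∀

  z-identity : ∀ x y z → + 44 ℤ.* z ≡
    + 4 ℤ.* ((x ℤ.* + 0 ℤ.+ (y ℤ.* + 2 ℤ.+ (z ℤ.* + 5 ℤ.+ + 0)))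
          ℤ.- (x ℤ.* + 0 ℤ.+ (y ℤ.* + 1 ℤ.+ (z ℤ.* ℤ.- (+ 6) ℤ.+ + 0))))
      ℤ.+ ((x ℤ.* + 0 ℤ.+ (y ℤ.* ℤ.- (+ 2) ℤ.+ (z ℤ.* + 5 ℤ.+ + 0)))
        ℤ.- (x ℤ.* + 0 ℤ.+ (y ℤ.* + 2 ℤ.+ (z ℤ.* + 5 ℤ.+ + 0))))
  z-identity = solve-∀

box : List Triple
box = cartesianProduct (interval 27) (cartesianProduct (interval 2) (interval 1))

short⇒∈box : ∀ h → Short h → triple h ∈ box
short⇒∈box h short =
  let x≤ , y≤ , z≤ = short⇒≤ h short
      ≤x , ≤y , ≤z = short⇒≤ (ℤ.- + 1 •ᶻ h) (Short-± {h} (inj₂ refl) short)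
  in ∈-cartesianProduct⁺ (∈-interval (negate ≤x) x≤)
       (∈-cartesianProduct⁺ (∈-interval (negate ≤y) y≤) (∈-interval (negate ≤z) z≤))
  where
  negate : ∀ {i n} → ℤ.- + 1 ℤ.* i ℤ.≤ n → ℤ.- n ℤ.≤ i
  negate {i} {n} -i≤n = subst (ℤ.- n ℤ.≤_)
    (trans (cong ℤ.-_ (ℤ.-1*i≡-i i)) (ℤ.neg-involutive i)) (ℤ.neg-mono-≤ -i≤n)

short-with-nonzero : Fin 3 → List Triple
short-with-nonzero k = filter (λ h → short? (vector h) ×-dec ¬? (vector h k ℤ.≟ + 0)) box

-- Heights above the lowest value

lowest : ∀ {n} → Vector ℤ (suc n) → ℤ
-- The base value is itself an entry, so it does not change the minimum.
lowest f = foldr _⊓_ (f zero) f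

lowest-greatest : ∀ {n} (f : Vector ℤ (suc n)) {b} → (∀ i → b ℤ.≤ f i) → b ℤ.≤ lowest f
lowest-greatest f {b} b≤f = go f b≤f
  where
  go : ∀ {n} (g : Vector ℤ n) → (∀ i → b ℤ.≤ g i) → b ℤ.≤ foldr _⊓_ (f zero) g
  go {zero}  g b≤g = b≤f zero
  go {suc n} g b≤g = ℤ.⊓-glb (b≤g zero) (go (g ∘ suc) (b≤g ∘ suc))

height : ∀ {n} → Vector ℤ (suc n) → Vector ℤ (suc n)
height f i = f i ℤ.- lowest f

-- A height is the value after the translation that moves the minimum to 0, the least a simplex
-- coordinate can be. The constant 14 just exceeds 13.
record Spread {n} (f g : Vector ℤ (suc n)) : Set where
  constructor mkSpread
  field
    index : Fin (suc n)
    14≤   : + 14 ℤ.≤ height f index ℤ.+ height g index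

spread? : ∀ {n} (f g : Vector ℤ (suc n)) → Dec (Spread f g)
spread? f g = map′ (λ (i , 14≤) → mkSpread i 14≤) (λ (mkSpread i 14≤) → i , 14≤)
  (Fin.any? λ i → + 14 ℤ.≤? height f i ℤ.+ height g i)

values : ℤ^ 3 → Vector ℤ 6
values h i = h ∙ points i

All-cartesianProduct-lookup : ∀ {A B : Set} (R : A → B → Set) xs ys →
  All (λ (x , y) → R x y) (cartesianProduct xs ys) → ∀ {x y} → x ∈ xs → y ∈ ys → R x y
All-cartesianProduct-lookup R xs ys all x∈ y∈ = All.lookup all (∈-cartesianProduct⁺ x∈ y∈)

-- Abstract, so that indices found by exhaustive search are never evaluated.
abstract
  all-spread : All (λ (u , v) → Spread (values (vector u)) (values (vector v)))
    (cartesianProduct (short-with-nonzero (suc zero)) (short-with-nonzero (suc (suc zero))))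
  all-spread = from-yes (All.all? (λ (u , v) → spread? (values (vector u)) (values (vector v)))
    (cartesianProduct (short-with-nonzero (suc zero)) (short-with-nonzero (suc (suc zero)))))

  all-axial : All (λ u → vector u (suc (suc zero)) ≡ + 0) (short-with-nonzero (suc zero))
  all-axial = from-yes (All.all? (λ u → vector u (suc (suc zero)) ℤ.≟ + 0) (short-with-nonzero (suc zero)))

  all-positive-width : All
    (λ h → h ≡ (+ 0 , + 0 , + 0) ⊎ ∃ λ i → ∃ λ j → + 1 ℤ.≤ vector h ∙ points i ℤ.- vector h ∙ points j) box
  all-positive-width = from-yes (All.all? (λ h → ≡-dec ℤ._≟_ (≡-dec ℤ._≟_ ℤ._≟_) h (+ 0 , + 0 , + 0)
    ⊎-dec Fin.any? λ i → Fin.any? λ j → + 1 ℤ.≤? vector h ∙ points i ℤ.- vector h ∙ points j) box)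

-- Widths of convex hulls of integral points

module _ {d n} (p : Vector (ℤ^ d) (suc n)) where
  open Width p

  private
    S : Region d
    S = conv λ i → ι (p i)

  ≤⟨,⟩ : ∀ h {z} → (∀ i → z ℤ.≤ h ∙ p i) → ∀ i → fromℤ z ≤ ⟨ ι h , ι (p i) ⟩
  ≤⟨,⟩ h z≤ i = ≤-trans (fromℤ-mono-≤ (z≤ i)) (proj₂ (⟨ι,ι⟩ h (p i)))

  ⟨,⟩≤ : ∀ h {z} → (∀ i → h ∙ p i ℤ.≤ z) → ∀ i → ⟨ ι h , ι (p i) ⟩ ≤ fromℤ z
  ⟨,⟩≤ h ≤z i = ≤-trans (proj₁ (⟨ι,ι⟩ h (p i))) (fromℤ-mono-≤ (≤z i))

  value∈ : ∀ h i → ∃ λ x → S x × fromℤ (h ∙ p i) ≈ ⟨ ι h , x ⟩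
  value∈ h i = ι (p i) , vertex∈conv (λ i → ι (p i)) i , ≈-sym (⟨ι,ι⟩ h (p i))

  fromℤ-minus : ∀ a b → fromℤ (a ℤ.- b) ≈ fromℤ a - fromℤ b
  fromℤ-minus a b = ≈-trans (fromℤ-+ a (ℤ.- b)) (R.+-congˡ {fromℤ a} (fromℤ-neg b))

  width-correct : ∀ h → HasWidth S (ι h) (fromℤ (width h))
  width-correct h = fromℤ (h ∙ p (top h)) , fromℤ (h ∙ p (bottom h))
    , (value∈ h (top h) , λ (x , x∈S , r≈) →
        ≤-trans (proj₁ r≈) (conv-≤ (ι h) (⟨,⟩≤ h (≤top h)) x∈S))
    , (value∈ h (bottom h) , λ (x , x∈S , r≈) →
        ≤-trans (conv-≥ (ι h) (≤⟨,⟩ h (bottom≤ h)) x∈S) (proj₂ r≈))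
    , fromℤ-minus (h ∙ p (top h)) (h ∙ p (bottom h))

  difference≤HasWidth : ∀ h {w} → HasWidth S (ι h) w → ∀ i j → fromℤ (h ∙ p i ℤ.- h ∙ p j) ≤ w
  difference≤HasWidth h {w} (M , m , (_ , ≤M) , (_ , m≤) , w≈) i j = begin
    fromℤ (h ∙ p i ℤ.- h ∙ p j)          ≈⟨ fromℤ-minus (h ∙ p i) (h ∙ p j) ⟩
    fromℤ (h ∙ p i) - fromℤ (h ∙ p j)    ≲⟨ +-mono-≤ (≤M (value∈ h i)) (-‿anti-≤ (m≤ (value∈ h j))) ⟩
    M - m                                ≈⟨ w≈ ⟨
    w                                    ∎
    where open PreorderReasoning ≤-preorder

  NormLe⇒width≤ : ∀ h k → NormLe S h k → width h ℤ.≤ width k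
  NormLe⇒width≤ h k le = fromℤ-cancel-≤ (le (width-correct h) (width-correct k))

-- Dilated simplices

module _ {d : ℕ} {l : ℝ} (0≤l : 0ℝ ≤ l) where
  open PreorderReasoning ≤-preorder

  private
    vertices : Vector (ℝ^ d) (suc d)
    vertices = (λ _ → 0ℝ) ∷ λ i → ι (δ i)

  Δ-point : ∀ (c : Vector ℝ (suc d)) j → (∑ λ i → c i * vertices i j) ≈ c (suc j)
  Δ-point c j = ≈-trans (R.+-cong (R.zeroʳ (c zero)) (∑-δʳ (c ∘ suc) j)) (R.+-identityˡ (c (suc j)))

  ∈lΔ⇒ : ∀ {y} → image (l •_) (Δ d) y → (∀ j → 0ℝ ≤ y j) × ∑ y ≤ l
  ∈lΔ⇒ {y} (z , (c , 0≤c , ∑c≈1 , z≋) , y≋) =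
    (λ j → ≤-trans (*-nonNeg 0≤l (0≤c (suc j))) (proj₂ (y≈lc j))) , (begin
      ∑ y                     ≈⟨ R.sum-cong-≋ y≈lc ⟩
      (∑ λ j → l * c (suc j)) ≈⟨ R.*-distribˡ-sum l (c ∘ suc) ⟨
      l * ∑ (c ∘ suc)         ≈⟨ *-cong {l} ≈-refl (R.+-identityˡ (∑ (c ∘ suc))) ⟨
      l * (0ℝ + ∑ (c ∘ suc))  ≲⟨ *-monoˡ-≤ 0≤l (+-mono-≤ (0≤c zero) (≤-refl {∑ (c ∘ suc)})) ⟩
      l * ∑ c                 ≈⟨ *-cong {l} ≈-refl ∑c≈1 ⟩
      l * 1ℝ                  ≈⟨ R.*-identityʳ l ⟩
      l                       ∎)
    where
    y≈lc : ∀ j → y j ≈ l * c (suc j)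
    y≈lc j = ≈-trans (y≋ j) (*-cong {l} ≈-refl (≈-trans (z≋ j) (Δ-point c j)))

  -- The origin receives the slack 1 - s ∑ y as its weight. The reciprocal s of l is an argument
  -- because `0ℝ ≤ l` alone does not provide one.
  ⇒∈lΔ : ∀ {s} → 0ℝ ≤ s → l * s ≈ 1ℝ → ∀ {y} → (∀ j → 0ℝ ≤ y j) → ∑ y ≤ l → image (l •_) (Δ d) y
  ⇒∈lΔ {s} 0≤s ls≈1 {y} 0≤y ∑y≤l = (s • y) , (c , 0≤c , ∑c≈1 , λ j → ≈-sym (Δ-point c j)) , y≋lsy
    where
    c : Vector ℝ (suc d)
    c = (1ℝ - s * ∑ y) ∷ (s • y)

    s∑y≤1 : s * ∑ y ≤ 1ℝ
    s∑y≤1 = ≤-trans (*-monoˡ-≤ 0≤s ∑y≤l) (proj₁ (≈-trans (R.*-comm s l) ls≈1))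

    0≤c : ∀ i → 0ℝ ≤ c i
    0≤c zero    = x≤y⇒0≤y-x s∑y≤1
    0≤c (suc j) = *-nonNeg 0≤s (0≤y j)

    ∑c≈1 : ∑ c ≈ 1ℝ
    ∑c≈1 = ≈-trans (R.+-congˡ {1ℝ - s * ∑ y} (≈-sym (R.*-distribˡ-sum s y)))
      (≈-pointwise λ n → solve 1 (λ u → con 1ℚ :+ (:- u) :+ u := con 1ℚ) refl (seq (s * ∑ y) n))

    y≋lsy : y ≋ l • s • y
    y≋lsy j = ≈-sym (≈-trans (≈-sym (R.*-assoc l s (y j)))
      (≈-trans (*-cong ls≈1 ≈-refl) (R.*-identityˡ (y j))))

-- Each facet inequality of the simplex is affine, so checking the generators suffices. For the
-- slanted facet the functional is the sum of the rows of A.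
affine-fits : ∀ {d n} (p : Vector (ℤ^ d) (suc n)) (A : Matrix d) (t : ℤ^ d) {l s} →
  0ℝ ≤ l → 0ℝ ≤ s → l * s ≈ 1ℝ →
  (∀ k i → ℤ.- t k ℤ.≤ A k ∙ p i) →
  (∀ i → fromℤ ((λ j → ∑ᶻ λ k → A k j) ∙ p i ℤ.+ ∑ᶻ t) ≤ l) →
  ∀ {y} → image (affine A t) (conv λ i → ι (p i)) y → image (l •_) (Δ d) y
affine-fits {d} p A t {l} {s} 0≤l 0≤s ls≈1 -t≤A A+t≤l {y} (x , x∈S , y≋) = ⇒∈lΔ 0≤l 0≤s ls≈1 0≤y ∑y≤l
  where
  open PreorderReasoning ≤-preorder

  0≤y : ∀ k → 0ℝ ≤ y k
  0≤y k = begin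
    0ℝ                                ≈⟨ R.-‿inverseˡ (fromℤ (t k)) ⟨
    -ℝ (fromℤ (t k)) + fromℤ (t k)    ≈⟨ R.+-congʳ {fromℤ (t k)} (fromℤ-neg (t k)) ⟨
    fromℤ (ℤ.- t k) + fromℤ (t k)     ≲⟨ +-mono-≤ (conv-≥ (ι (A k)) (≤⟨,⟩ p (A k) (-t≤A k)) x∈S) ≤-refl ⟩
    ⟨ ι (A k) , x ⟩ + fromℤ (t k)     ≈⟨ y≋ k ⟨
    y k                               ∎

  columns : ℤ^ d
  columns j = ∑ᶻ λ k → A k j

  columns≤ : ∀ i → ⟨ ι columns , ι (p i) ⟩ ≤ l - fromℤ (∑ᶻ t)
  columns≤ i = begin
    ⟨ ι columns , ι (p i) ⟩
      ≈⟨ ⟨ι,ι⟩ columns (p i) ⟩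
    fromℤ (columns ∙ p i)
      ≈⟨ ≈-pointwise (λ _ → solve 2 (λ a b → a := a :+ b :+ (:- b)) refl ((columns ∙ p i) ℚ./ 1) (∑ᶻ t ℚ./ 1)) ⟩
    fromℤ (columns ∙ p i) + fromℤ (∑ᶻ t) - fromℤ (∑ᶻ t)
      ≈⟨ R.+-congʳ { -ℝ fromℤ (∑ᶻ t)} (fromℤ-+ (columns ∙ p i) (∑ᶻ t)) ⟨
    fromℤ (columns ∙ p i ℤ.+ ∑ᶻ t) - fromℤ (∑ᶻ t)
      ≲⟨ +-mono-≤ (A+t≤l i) ≤-refl ⟩
    l - fromℤ (∑ᶻ t) ∎

  ∑y≤l : ∑ y ≤ l
  ∑y≤l = begin
    ∑ y
      ≈⟨ R.sum-cong-≋ y≋ ⟩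
    (∑ λ k → ⟨ ι (A k) , x ⟩ + fromℤ (t k))
      ≈⟨ R.∑-distrib-+ (λ k → ⟨ ι (A k) , x ⟩) (λ k → fromℤ (t k)) ⟩
    (∑ λ k → ⟨ ι (A k) , x ⟩) + (∑ λ k → fromℤ (t k))
      ≈⟨ R.+-cong (R.∑-comm (λ k j → fromℤ (A k j) * x j)) (≈-sym (fromℤ-∑ t)) ⟩
    (∑ λ j → ∑ λ k → fromℤ (A k j) * x j) + fromℤ (∑ᶻ t)
      ≈⟨ R.+-congʳ {fromℤ (∑ᶻ t)} (R.sum-cong-≋ λ j → ≈-trans
           (≈-sym (R.*-distribʳ-sum (x j) (λ k → fromℤ (A k j))))
           (*-cong {y = x j} (≈-sym (fromℤ-∑ (λ k → A k j))) ≈-refl)) ⟩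
    ⟨ ι columns , x ⟩ + fromℤ (∑ᶻ t)
      ≲⟨ +-mono-≤ (conv-≤ (ι columns) columns≤ x∈S) ≤-refl ⟩
    l - fromℤ (∑ᶻ t) + fromℤ (∑ᶻ t)
      ≈⟨ ≈-pointwise (λ n → solve 2 (λ a b → a :+ (:- b) :+ b := a) refl (seq l n) (∑ᶻ t ℚ./ 1)) ⟩
    l ∎

linear-ι : ∀ {d} (A : Matrix d) (v : ℤ^ d) → linear A (ι v) ≋ ι (λ k → A k ∙ v)
linear-ι A v k = ⟨ι,ι⟩ (A k) v

affine-ι : ∀ {d} (A : Matrix d) (t v : ℤ^ d) → affine A t (ι v) ≋ ι ((λ k → A k ∙ v) +ᶻ t)
affine-ι A t v k = ≈-trans (R.+-congʳ {fromℤ (t k)} (linear-ι A v k)) (≈-sym (fromℤ-+ (A k ∙ v) (t k)))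

diagonal-∙ : ∀ {d} {D : Matrix d} → SignDiagonal d D → ∀ k v → D k ∙ v ≡ D k k ℤ.* v k
diagonal-∙ {D = D} (_ , off) k v = sum-single ℤ.+-*-commutativeRing (λ j → D k j ℤ.* v j) k
  λ j k≢j → cong (ℤ._* v j) (off k j k≢j)

-- Evaluation at the generators turns the containment of real regions into integer inequalities; the
-- signs of the diagonal matrix are absorbed into the rows of A.
naive-fit⇒ : ∀ {d n} (p : Vector (ℤ^ d) (suc n)) (A : Matrix d) {l m} →
  l ≤ fromℤ m → FitsIn (SignDiagonal d) (image (linear A) (conv λ i → ι (p i))) l →
  ∃ λ (σ : ℤ^ d) → ∃ λ (t : ℤ^ d) → (∀ k → σ k ≡ + 1 ⊎ σ k ≡ ℤ.- + 1)
    × (∀ k i → ℤ.- t k ℤ.≤ (σ k •ᶻ A k) ∙ p i)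
    × (∀ i → ∑ᶻ (λ k → (σ k •ᶻ A k) ∙ p i ℤ.+ t k) ℤ.≤ m)
naive-fit⇒ {d} p A {l} {m} l≤m (0≤l , D , t , diagonal , fits) = σ , t , proj₁ diagonal , -t≤ , ∑≤m
  where
  open PreorderReasoning ≤-preorder
  σ : ℤ^ d
  σ k = D k k

  w : ∀ i → ℤ^ d
  w i k = A k ∙ p i

  integral : ∀ i k → (D k ∙ w i) ℤ.+ t k ≡ (σ k •ᶻ A k) ∙ p i ℤ.+ t k
  integral i k = cong (ℤ._+ t k) (trans (diagonal-∙ diagonal k (w i)) (sym (∙-•ˡ (σ k) (A k) (p i))))

  y : ∀ i → ℝ^ d
  y i = affine D t (linear A (ι (p i)))

  y≈ : ∀ i k → y i k ≈ fromℤ ((σ k •ᶻ A k) ∙ p i ℤ.+ t k)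
  y≈ i k = ≈-trans
    (R.+-congʳ {fromℤ (t k)} (⟨,⟩-congʳ (ι (D k)) (linear-ι A (p i))))
    (≈-trans (affine-ι D t (w i) k) (fromℤ-cong (integral i k)))

  y∈lΔ : ∀ i → (∀ k → 0ℝ ≤ y i k) × ∑ (y i) ≤ l
  y∈lΔ i = ∈lΔ⇒ 0≤l (fits (linear A (ι (p i))
    , (ι (p i) , vertex∈conv (λ i → ι (p i)) i , λ _ → ≈-refl) , λ _ → ≈-refl))

  -t≤ : ∀ k i → ℤ.- t k ℤ.≤ (σ k •ᶻ A k) ∙ p i
  -t≤ k i = subst₂ ℤ._≤_ (ℤ.+-identityˡ (ℤ.- t k)) (cancel ((σ k •ᶻ A k) ∙ p i) (t k))
    (ℤ.+-monoˡ-≤ (ℤ.- t k) (fromℤ-cancel-≤ {+ 0} {(σ k •ᶻ A k) ∙ p i ℤ.+ t k} (≤-trans (proj₁ (y∈lΔ i) k) (proj₁ (y≈ i k)))))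
    where
    cancel : ∀ a b → a ℤ.+ b ℤ.- b ≡ a
    cancel = solve-∀

  ∑≤m : ∀ i → ∑ᶻ (λ k → (σ k •ᶻ A k) ∙ p i ℤ.+ t k) ℤ.≤ m
  ∑≤m i = fromℤ-cancel-≤ (begin
    fromℤ (∑ᶻ λ k → (σ k •ᶻ A k) ∙ p i ℤ.+ t k)      ≈⟨ fromℤ-∑ (λ k → (σ k •ᶻ A k) ∙ p i ℤ.+ t k) ⟩
    (∑ λ k → fromℤ ((σ k •ᶻ A k) ∙ p i ℤ.+ t k))     ≈⟨ R.sum-cong-≋ (y≈ i) ⟨
    ∑ (y i)                                          ≲⟨ proj₂ (y∈lΔ i) ⟩
    l                                                ≲⟨ l≤m ⟩
    fromℤ m                                          ∎)

-- The polytope P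

vector-triple : ∀ h → vector (triple h) ≗ h
vector-triple h zero             = refl
vector-triple h (suc zero)       = refl
vector-triple h (suc (suc zero)) = refl

-- If no difference were positive, all would be at most 0, so h would be short and lie in the box.
-- There the search leaves only the zero vector, whose gcd is 0.
positive-width : ∀ h → Primitive h → ∃ λ i → ∃ λ j → + 1 ℤ.≤ h ∙ points i ℤ.- h ∙ points j
positive-width h h-primitive with Fin.any? (λ i → Fin.any? λ j → + 1 ℤ.≤? h ∙ points i ℤ.- h ∙ points j)
... | yes found = found
... | no none = [ (λ eq → contradiction h-primitive (not-primitive eq)) , id ]′
    (All.lookup all-positive-width (short⇒∈box h λ i j →
      ℤ.≤-trans (ℤ.≮⇒≥ λ lt → none (i , j , ℤ.i<j⇒suc[i]≤j lt)) (ℤ.+≤+ ℕ.z≤n)))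
  where
  not-primitive : triple h ≡ (+ 0 , + 0 , + 0) → ¬ Primitive h
  not-primitive eq h-primitive with trans (sym h-primitive)
    (cong (λ (x , y , z) → gcd x (gcd y (gcd z (+ 0)))) eq)
  ... | ()

latticeWidth : HasLatticeWidth P 1ℝ
latticeWidth = (δ zero , refl , width-correct points (δ zero))
  , λ (h , h-primitive , hasWidth) →
      let i , j , 1≤ = positive-width h h-primitive
      in ≤-trans (fromℤ-mono-≤ 1≤) (difference≤HasWidth points h hasWidth i j)

fits-in-13Δ : FitsIn (GL 3) P (fromℤ (+ 13))
fits-in-13Δ = 0≤13 , A , t , (B , from-yes (Fin.all? λ i → Fin.all? λ j → (A · B) i j ℤ.≟ δ i j)
                            , from-yes (Fin.all? λ i → Fin.all? λ j → (B · A) i j ℤ.≟ δ i j))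
  , affine-fits points A t 0≤13 (fromℚ-mono-≤ {q = + 1 ℚ./ 13} (ℚ.nonNegative⁻¹ _)) (≈-pointwise λ _ → refl)
      (from-yes (Fin.all? λ k → Fin.all? λ i → ℤ.- t k ℤ.≤? A k ∙ points i))
      λ i → fromℤ-mono-≤ (from-yes (Fin.all? λ i → (λ j → ∑ᶻ λ k → A k j) ∙ points i ℤ.+ ∑ᶻ t ℤ.≤? + 13) i)
  where
  A B : Matrix 3
  A = (ℤ.- + 10 ∷ ℤ.- + 1 ∷ ℤ.- + 1 ∷ [])
    ∷ (+ 0 ∷ ℤ.- + 1 ∷ + 0 ∷ [])
    ∷ (+ 1 ∷ + 0 ∷ + 0 ∷ [])
    ∷ []
  B = (+ 0 ∷ + 0 ∷ + 1 ∷ [])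
    ∷ (+ 0 ∷ ℤ.- + 1 ∷ + 0 ∷ [])
    ∷ (ℤ.- + 1 ∷ + 1 ∷ ℤ.- + 10 ∷ [])
    ∷ []
  t : ℤ^ 3
  -- The rows have minima -7, -2 and 0 on the points, which `t` moves to 0. The third point goes to
  -- (12, 1, 0), where the coordinate sum 13 is attained.
  t = + 7 ∷ + 2 ∷ + 0 ∷ []
  0≤13 : 0ℝ ≤ fromℤ (+ 13)
  0≤13 = fromℤ-mono-≤ {+ 0} {+ 13} (ℤ.+≤+ ℕ.z≤n)

∈-short-with-nonzero : ∀ h j → Short h → h j ≢ + 0 → triple h ∈ short-with-nonzero j
∈-short-with-nonzero h j short h≢0 = ∈-filter⁺
  (λ h → short? (vector h) ×-dec ¬? (vector h j ℤ.≟ + 0)) (short⇒∈box h short)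
  (short , h≢0 ∘ trans (sym (vector-triple h j)))

-- Settled by enumeration; by hand, the differences (0,1,11) and (0,3,-11) bound |y + 11z| and |3y -
-- 11z| by 11, which for z = ±1 forces y = 0.
short⇒axial : ∀ u → Short u → u (suc zero) ≢ + 0 → u (suc (suc zero)) ≡ + 0
short⇒axial u short u≢0 = All.lookup all-axial (∈-short-with-nonzero u (suc zero) short u≢0)

-- Settled by enumeration; by hand, u = (x, ±1, 0) and v = (x′, 0, ±1). If v₃ = 1, the first two
-- points have v-height at least 11 and u separates them by 4. If v₃ = -1, the third point has
-- heights at least 3 and 11 when u₂ = 1, and the sixth at least 6 and 8 when u₂ = -1.
short⇒spread : ∀ u v → Short u → Short v → u (suc zero) ≢ + 0 → v (suc (suc zero)) ≢ + 0 → Spread (values u) (values v)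
short⇒spread u v u-short v-short u≢0 v≢0 = All-cartesianProduct-lookup
  (λ u v → Spread (values (vector u)) (values (vector v)))
  (short-with-nonzero (suc zero)) (short-with-nonzero (suc (suc zero))) all-spread
  (∈-short-with-nonzero u (suc zero) u-short u≢0) (∈-short-with-nonzero v (suc (suc zero)) v-short v≢0)

-- No admissible translation brings a coordinate below its height, and the remaining row contributes
-- a nonnegative amount.
short⇒¬narrow : ∀ (u : Vector (ℤ^ 3) 3) (t : ℤ^ 3) → (∀ k → Short (u k)) →
  (∀ k i → ℤ.- t k ℤ.≤ u k ∙ points i) →
  ∀ k₁ k₂ → u k₁ (suc zero) ≢ + 0 → u k₂ (suc (suc zero)) ≢ + 0 →
  ∃ λ i → + 14 ℤ.≤ ∑ᶻ λ k → u k ∙ points i ℤ.+ t k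
short⇒¬narrow u t u-short -t≤ k₁ k₂ u₁≢0 u₂≢0 = i , (begin
  + 14
    ≤⟨ Spread.14≤ spread ⟩
  height (values (u k₁)) i ℤ.+ height (values (u k₂)) i
    ≤⟨ ℤ.+-mono-≤ (height≤ k₁) (height≤ k₂) ⟩
  term k₁ ℤ.+ term k₂
    ≤⟨ fᵢ+fⱼ≤∑ᶻ term 0≤term k₁≢k₂ ⟩
  ∑ᶻ term ∎)
  where
  open ℤ.≤-Reasoning
  spread = short⇒spread (u k₁) (u k₂) (u-short k₁) (u-short k₂) u₁≢0 u₂≢0
  i = Spread.index spread

  k₁≢k₂ : k₁ ≢ k₂
  k₁≢k₂ refl = u₂≢0 (short⇒axial (u k₁) (u-short k₁) u₁≢0)

  term : Fin 3 → ℤ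
  term k = u k ∙ points i ℤ.+ t k

  height≤ : ∀ k → height (values (u k)) i ℤ.≤ term k
  height≤ k = ℤ.+-monoʳ-≤ (u k ∙ points i) (ℤ.≤-trans
    (ℤ.neg-mono-≤ (lowest-greatest (values (u k)) (-t≤ k))) (ℤ.≤-reflexive (ℤ.neg-involutive (t k))))

  0≤term : ∀ k → + 0 ℤ.≤ term k
  0≤term k = ℤ.≤-trans (ℤ.≤-reflexive (sym (ℤ.+-inverseˡ (t k)))) (ℤ.+-monoˡ-≤ (t k) (-t≤ k i))

-- Reduced bases of the lattice with respect to P

module _ (b : Vector (ℤ^ 3) 3) where
  open Width points

  private
    h₁ h₂ h₃ : ℤ^ 3
    h₁ = b zero
    h₂ = b (suc zero)
    h₃ = b (suc (suc zero))

  reduced⇒short : IsBasis b → IsReduced P h₁ h₂ h₃ → ∀ i → Short (b i)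
  reduced⇒short basis reduced i j k = ℤ.≤-trans (difference≤width (b i) j k) (width≤11 i)
    where
    open IsReduced reduced
    open Basis {b = b} basis

    w₁≤w₂ : width h₁ ℤ.≤ width h₂
    w₁≤w₂ = NormLe⇒width≤ points h₁ h₂ ‖h₁‖≤‖h₂‖

    w₂≤w₃ : width h₂ ℤ.≤ width h₃
    w₂≤w₃ = NormLe⇒width≤ points h₂ h₃ ‖h₂‖≤‖h₃‖

    unit-short : ∀ j → Short (δ j)
    unit-short = from-yes (Fin.all? λ j → short? (δ j))

    value : ∀ l i → δ l ∙ points i ≡ ∑ᶻ λ k → coordinates (δ l) k ℤ.* (b k ∙ points i)
    value l i = trans (∙-congˡ (λ j → sym (coordinates-∑ (δ l) j)) (points i))
      (∙-∑ˡ (coordinates (δ l)) b (points i))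

    w₃≤11 : width h₃ ℤ.≤ + 11
    w₃≤11 = let l , 2∤ = odd-coordinate (suc (suc zero)) in
      odd-coefficient h₁ h₂ h₃ (ℤ.≤-trans w₁≤w₂ w₂≤w₃) w₂≤w₃
        (λ m n → NormLe⇒width≤ points h₃ (m •ᶻ h₁ +ᶻ n •ᶻ h₂ +ᶻ h₃) (‖h₃‖≤‖mh₁+nh₂+h₃‖ m n))
        (coordinates (δ l) zero) (coordinates (δ l) (suc zero)) (coordinates (δ l) (suc (suc zero)))
        2∤ (λ i → δ l ∙ points i) (unit-short l) (value l)

    width≤11 : ∀ i → width (b i) ℤ.≤ + 11
    width≤11 zero             = ℤ.≤-trans w₁≤w₂ (ℤ.≤-trans w₂≤w₃ w₃≤11)
    width≤11 (suc zero)       = ℤ.≤-trans w₂≤w₃ w₃≤11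
    width≤11 (suc (suc zero)) = w₃≤11

  short⇒¬fits : IsBasis b → (∀ i → Short (b i)) →
    ∀ {l} → l ≤ fromℤ (+ 13) → ¬ FitsIn (SignDiagonal 3) (image (linear b) P) l
  short⇒¬fits basis b-short l≤13 fits =
    let k₁ , b₁≢0 = nonzero-entry (suc zero)
        k₂ , b₂≢0 = nonzero-entry (suc (suc zero))
        σ , t , ±1 , -t≤ , ∑≤13 = naive-fit⇒ points b l≤13 fits
        i , 14≤ = short⇒¬narrow (λ k → σ k •ᶻ b k) t (λ k → Short-± {b k} (±1 k) (b-short k)) -t≤ k₁ k₂
                    (±1*≢0 (±1 k₁) b₁≢0) (±1*≢0 (±1 k₂) b₂≢0)
    in contradiction (ℤ.≤-trans 14≤ (∑≤13 i)) (from-yes (¬? (+ 14 ℤ.≤? + 13)))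
    where
    open Basis {b = b} basis using (nonzero-entry)

    ±1*≢0 : ∀ {s x} → s ≡ + 1 ⊎ s ≡ ℤ.- + 1 → x ≢ + 0 → s ℤ.* x ≢ + 0
    ±1*≢0 {x = x} (inj₁ refl) x≢0 eq = x≢0 (trans (sym (ℤ.*-identityˡ x)) eq)
    ±1*≢0 {x = x} (inj₂ refl) x≢0 eq = x≢0 (ℤ.neg-injective (trans (sym (ℤ.-1*i≡-i x)) eq))

mainTheorem3 :
    IsLatticePolytope P
      × HasLatticeWidth P 1ℝ
      × ¬ (Σ (ℤ^ 3) λ h₁ → Σ (ℤ^ 3) λ h₂ → Σ (ℤ^ 3) λ h₃ →
            IsBasis (h₁ ∷ h₂ ∷ h₃ ∷ [])
              × IsReduced P h₁ h₂ h₃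
              × ComputesLatticeSize P (h₁ ∷ h₂ ∷ h₃ ∷ []))
mainTheorem3 = conv-isLatticePolytope points , latticeWidth ,
  λ (h₁ , h₂ , h₃ , basis , reduced , l , (_ , l≤) , (fits , _)) →
    let b = h₁ ∷ h₂ ∷ h₃ ∷ []
    -- The common value l is at most 13 by minimality over all unimodular maps, while the naive fit
    -- at the same l would need at least 14.
    in short⇒¬fits b basis (reduced⇒short b basis reduced) (l≤ fits-in-13Δ) fits
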